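{- Let $n,t,\delta$ be integers with $n\ge 3$ and $3\le t+1\le \delta\le \left\lfloor \frac{n+t-2}{2}\right\rfloor$, let $\alpha\in[0,1)$, and let $h=\left\lfloor \frac{n+t-2}{2}\right\rfloor$. Put $$f_1(n,t,\delta,2)=\binom{n+t-\delta-1}{2}+(\delta-t+1)\delta,\qquad g_1(n,t,\delta,2)=\binom{n+t-h-1}{2}+(h-t)h+\delta,$$ and $h_1=\max\{f_1(n,t,\delta,2),\,g_1(n,t,\delta,2)\}$. Let $G$ be a finite, simple, connected graph of order $n$ with minimum degree $\delta$. If $$\lambda_\alpha(G)>\frac{\delta+\alpha n-\alpha\delta-1+\sqrt{(\delta+\alpha n-\alpha\delta-1)^2+4(1-\alpha)(2h_1-n\delta+\delta)}}{2},$$ then $G$ is one-to-many $t$-disjoint path coverable.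
   Context: The order of a graph is its number of vertices. For $\alpha\in[0,1)$, $A_\alpha(G)=\alpha D(G)+(1-\alpha)A(G)$, where $A(G)$ is the adjacency matrix and $D(G)$ the diagonal matrix of vertex degrees of $G$; the $\alpha$-spectral radius $\lambda_\alpha(G)$ is the largest eigenvalue of $A_\alpha(G)$. A graph $G$ is one-to-many $t$-disjoint path coverable if for any vertex $u$ and any set $\{v_1,\dots,v_t\}$ of $t$ distinct vertices of $G$ not containing $u$, there exist $t$ paths $P_1,\dots,P_t$ in $G$ such that $P_i$ joins $u$ and $v_i$, every vertex of $G$ lies on at least one of the paths, and any two of the paths have no common vertex other than $u$. -}

module Defs where

open import Data.Bool.Base using (Bool; false; T; if_then_else_)
open import Data.Fin.Base using (Fin)
open import Data.Fin.Properties using () renaming (_≟_ to _≟F_)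
open import Data.Fin.Subset using (Subset; ∣_∣)
open import Data.Integer.Base using (+_)
open import Data.List.Base using (List; head; last)
open import Data.List.Membership.Propositional using (_∈_)
open import Data.List.Relation.Unary.Linked using (Linked)
open import Data.List.Relation.Unary.Unique.Propositional using (Unique)
open import Data.Maybe.Base using (just)
open import Data.Nat.Base as ℕ using (ℕ)
open import Data.Nat.Combinatorics using (_C_)
import Data.Nat.Properties as ℕP
open import Data.Product.Base using (_×_; _,_; ∃-syntax; Σ-syntax)
open import Data.Rational.Base as ℚ using (ℚ; 0ℚ; 1ℚ; ½)
import Data.Rational.Properties as ℚP
import Data.Rational.Solver as ℚS
import Data.Vec.Base as Vec
open import Data.Vec.Functional using (Vector; foldr)
open import Function.Definitions using (Injective)
open import Relation.Binary.Construct.Closure.ReflexiveTransitive using (Star)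
open import Relation.Binary.PropositionalEquality.Core
  using (_≡_; _≢_; refl; sym; trans; cong; subst)
open import Relation.Nullary.Decidable.Core using (⌊_⌋)
open import Relation.Nullary.Negation.Core using (¬_)

------------------------------------------------------------------------
-- Real numbers: Cauchy sequences of rationals, with _≃_ as equality.

Cauchy : (ℕ → ℚ) → Set
Cauchy s = ∀ ε → 0ℚ ℚ.< ε →
  ∃[ N ] (∀ m n → N ℕ.≤ m → N ℕ.≤ n → ℚ.∣ s m ℚ.- s n ∣ ℚ.< ε)

record ℝ : Set where
  constructor mkℝ
  field
    seq    : ℕ → ℚ
    cauchy : Cauchy seq

open ℝ public

infix  4 _≃_ _<ᴿ_ _≤ᴿ_
infixl 6 _+ᴿ_ _-ᴿ_
infixl 7 _*ᴿ_
infix  8 -ᴿ_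

_≃_ : ℝ → ℝ → Set
x ≃ y = ∀ ε → 0ℚ ℚ.< ε →
  ∃[ N ] (∀ n → N ℕ.≤ n → ℚ.∣ seq x n ℚ.- seq y n ∣ ℚ.< ε)

_<ᴿ_ : ℝ → ℝ → Set
x <ᴿ y = ∃[ ε ] (0ℚ ℚ.< ε × ∃[ N ] (∀ n → N ℕ.≤ n → seq x n ℚ.+ ε ℚ.≤ seq y n))

_≤ᴿ_ : ℝ → ℝ → Set
x ≤ᴿ y = ¬ (y <ᴿ x)

fromℚ : ℚ → ℝ
fromℚ q = mkℝ (λ _ → q) λ ε 0<ε → 0 , λ _ _ _ _ →
  subst (λ z → ℚ.∣ z ∣ ℚ.< ε) (sym (ℚP.+-inverseʳ q)) 0<ε

fromℕ : ℕ → ℝ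
fromℕ n = fromℚ ((+ n) ℚ./ 1)

0ᴿ 1ᴿ : ℝ
0ᴿ = fromℚ 0ℚ
1ᴿ = fromℚ 1ℚ

module CauchyLemmas where
  half-pos : ∀ ε → 0ℚ ℚ.< ε → 0ℚ ℚ.< ½ ℚ.* ε
  half-pos ε 0<ε = ℚP.*-monoʳ-<-pos ½ 0<ε

  halves : ∀ ε → ½ ℚ.* ε ℚ.+ ½ ℚ.* ε ≡ ε
  halves ε = trans (sym (ℚP.*-distribʳ-+ ε ½ ½)) (ℚP.*-identityˡ ε)

  +-interchange : ∀ a b c d → (a ℚ.+ b) ℚ.- (c ℚ.+ d) ≡ (a ℚ.- c) ℚ.+ (b ℚ.- d)
  +-interchange = solve 4 (λ a b c d → (a :+ b) :- (c :+ d) := (a :- c) :+ (b :- d)) refl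
    where open ℚS.+-*-Solver

  *-split : ∀ a b c d → a ℚ.* b ℚ.- c ℚ.* d ≡ a ℚ.* (b ℚ.- d) ℚ.+ d ℚ.* (a ℚ.- c)
  *-split = solve 4 (λ a b c d → a :* b :- c :* d := a :* (b :- d) :+ d :* (a :- c)) refl
    where open ℚS.+-*-Solver

  sub-add : ∀ a b → a ≡ (a ℚ.- b) ℚ.+ b
  sub-add = solve 2 (λ a b → a := (a :- b) :+ b) refl
    where open ℚS.+-*-Solver

  neg-sub : ∀ a b → (ℚ.- a) ℚ.- (ℚ.- b) ≡ ℚ.- (a ℚ.- b)
  neg-sub = solve 2 (λ a b → (:- a) :- (:- b) := :- (a :- b)) refl
    where open ℚS.+-*-Solver

  0<1 : 0ℚ ℚ.< 1ℚ
  0<1 = ℚP.positive⁻¹ 1ℚ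

  ≤⊔ˡ : ∀ m n {k} → m ℕ.⊔ n ℕ.≤ k → m ℕ.≤ k
  ≤⊔ˡ m n = ℕP.≤-trans (ℕP.m≤m⊔n m n)

  ≤⊔ʳ : ∀ m n {k} → m ℕ.⊔ n ℕ.≤ k → n ℕ.≤ k
  ≤⊔ʳ m n = ℕP.≤-trans (ℕP.m≤n⊔m m n)

  bounded : ∀ s → Cauchy s →
    ∃[ N ] ∃[ B ] (0ℚ ℚ.< B × (∀ n → N ℕ.≤ n → ℚ.∣ s n ∣ ℚ.≤ B))
  bounded s cs with cs 1ℚ 0<1
  ... | N , p = N , 1ℚ ℚ.+ ℚ.∣ s N ∣ , 0<B , λ n N≤n → ℚP.≤-trans
          (ℚP.≤-reflexive (cong ℚ.∣_∣ (sub-add (s n) (s N))))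
          (ℚP.≤-trans (ℚP.∣p+q∣≤∣p∣+∣q∣ (s n ℚ.- s N) (s N))
            (ℚP.+-monoˡ-≤ ℚ.∣ s N ∣ (ℚP.<⇒≤ (p n N N≤n ℕP.≤-refl))))
    where
    0<B : 0ℚ ℚ.< 1ℚ ℚ.+ ℚ.∣ s N ∣
    0<B = ℚP.+-mono-<-≤ 0<1 (ℚP.0≤∣p∣ (s N))

  +-cauchy : ∀ s t → Cauchy s → Cauchy t → Cauchy (λ n → s n ℚ.+ t n)
  +-cauchy s t cs ct ε 0<ε
    with cs (½ ℚ.* ε) (half-pos ε 0<ε) | ct (½ ℚ.* ε) (half-pos ε 0<ε)
  ... | N , p | M , q = N ℕ.⊔ M , λ m n m≥ n≥ → begin-strict
      ℚ.∣ (s m ℚ.+ t m) ℚ.- (s n ℚ.+ t n) ∣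
        ≡⟨ cong ℚ.∣_∣ (+-interchange (s m) (t m) (s n) (t n)) ⟩
      ℚ.∣ (s m ℚ.- s n) ℚ.+ (t m ℚ.- t n) ∣
        ≤⟨ ℚP.∣p+q∣≤∣p∣+∣q∣ (s m ℚ.- s n) (t m ℚ.- t n) ⟩
      ℚ.∣ s m ℚ.- s n ∣ ℚ.+ ℚ.∣ t m ℚ.- t n ∣
        <⟨ ℚP.+-mono-< (p m n (≤⊔ˡ N M m≥) (≤⊔ˡ N M n≥)) (q m n (≤⊔ʳ N M m≥) (≤⊔ʳ N M n≥)) ⟩
      ½ ℚ.* ε ℚ.+ ½ ℚ.* ε
        ≡⟨ halves ε ⟩
      ε ∎
    where open ℚP.≤-Reasoning

  neg-cauchy : ∀ s → Cauchy s → Cauchy (λ n → ℚ.- s n)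
  neg-cauchy s cs ε 0<ε with cs ε 0<ε
  ... | N , p = N , λ m n m≥ n≥ → subst (ℚ._< ε)
        (sym (trans (cong ℚ.∣_∣ (neg-sub (s m) (s n))) (ℚP.∣-p∣≡∣p∣ (s m ℚ.- s n))))
        (p m n m≥ n≥)

  *-bound : ∀ a b B η → 0ℚ ℚ.< B → ℚ.∣ a ∣ ℚ.≤ B → ℚ.∣ b ∣ ℚ.< η →
            ℚ.∣ a ℚ.* b ∣ ℚ.< B ℚ.* η
  *-bound a b B η 0<B a≤B b<η = begin-strict
      ℚ.∣ a ℚ.* b ∣         ≡⟨ ℚP.∣p*q∣≡∣p∣*∣q∣ a b ⟩
      ℚ.∣ a ∣ ℚ.* ℚ.∣ b ∣   ≤⟨ ℚP.*-monoʳ-≤-nonNeg ℚ.∣ b ∣ {{ℚP.∣-∣-nonNeg b}} a≤B ⟩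
      B ℚ.* ℚ.∣ b ∣         <⟨ ℚP.*-monoʳ-<-pos B {{ℚ.positive 0<B}} b<η ⟩
      B ℚ.* η               ∎
    where open ℚP.≤-Reasoning

  *-shrink : ∀ B ε → 0ℚ ℚ.< B → 0ℚ ℚ.< ε → ∃[ η ] (0ℚ ℚ.< η × B ℚ.* η ≡ ε)
  *-shrink B ε 0<B 0<ε = r ℚ.* ε
    , subst (ℚ._< r ℚ.* ε) (ℚP.*-zeroʳ r) (ℚP.*-monoʳ-<-pos r {{ℚP.1/pos⇒pos B {{posB}}}} 0<ε)
    , trans (sym (ℚP.*-assoc B r ε))
        (trans (cong (ℚ._* ε) (ℚP.*-inverseʳ B {{nzB}})) (ℚP.*-identityˡ ε))
    where
    posB : ℚ.Positive B
    posB = ℚ.positive 0<B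
    nzB : ℚ.NonZero B
    nzB = ℚP.pos⇒nonZero B {{posB}}
    r : ℚ
    r = (ℚ.1/ B) {{nzB}}

  *-close : ∀ a b c d B K η → 0ℚ ℚ.< B → 0ℚ ℚ.< K →
            ℚ.∣ a ∣ ℚ.≤ B → ℚ.∣ d ∣ ℚ.≤ K →
            ℚ.∣ a ℚ.- c ∣ ℚ.< η → ℚ.∣ b ℚ.- d ∣ ℚ.< η →
            ℚ.∣ a ℚ.* b ℚ.- c ℚ.* d ∣ ℚ.< (B ℚ.+ K) ℚ.* η
  *-close a b c d B K η 0<B 0<K a≤B d≤K ac bd = begin-strict
      ℚ.∣ a ℚ.* b ℚ.- c ℚ.* d ∣
        ≡⟨ cong ℚ.∣_∣ (*-split a b c d) ⟩
      ℚ.∣ a ℚ.* (b ℚ.- d) ℚ.+ d ℚ.* (a ℚ.- c) ∣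
        ≤⟨ ℚP.∣p+q∣≤∣p∣+∣q∣ (a ℚ.* (b ℚ.- d)) (d ℚ.* (a ℚ.- c)) ⟩
      ℚ.∣ a ℚ.* (b ℚ.- d) ∣ ℚ.+ ℚ.∣ d ℚ.* (a ℚ.- c) ∣
        <⟨ ℚP.+-mono-< (*-bound a (b ℚ.- d) B η 0<B a≤B bd)
                       (*-bound d (a ℚ.- c) K η 0<K d≤K ac) ⟩
      B ℚ.* η ℚ.+ K ℚ.* η
        ≡⟨ sym (ℚP.*-distribʳ-+ η B K) ⟩
      (B ℚ.+ K) ℚ.* η ∎
    where open ℚP.≤-Reasoning

  *-cauchy : ∀ s t → Cauchy s → Cauchy t → Cauchy (λ n → s n ℚ.* t n)
  *-cauchy s t cs ct ε 0<ε =
    let N₁ , B , 0<B , s≤B = bounded s cs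
        N₂ , K , 0<K , t≤K = bounded t ct
        η , 0<η , eq = *-shrink (B ℚ.+ K) ε (ℚP.+-mono-< 0<B 0<K) 0<ε
        M₁ , p = cs η 0<η
        M₂ , q = ct η 0<η
    in (N₁ ℕ.⊔ N₂) ℕ.⊔ (M₁ ℕ.⊔ M₂) , λ m n m≥ n≥ →
      let N = N₁ ℕ.⊔ N₂
          M = M₁ ℕ.⊔ M₂
          M≤m = ≤⊔ʳ N M m≥
          M≤n = ≤⊔ʳ N M n≥
      in subst (ℚ.∣ s m ℚ.* t m ℚ.- s n ℚ.* t n ∣ ℚ.<_) eq
        (*-close (s m) (t m) (s n) (t n) B K η 0<B 0<K
          (s≤B m (≤⊔ˡ N₁ N₂ (≤⊔ˡ N M m≥))) (t≤K n (≤⊔ʳ N₁ N₂ (≤⊔ˡ N M n≥)))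
          (p m n (≤⊔ˡ M₁ M₂ M≤m) (≤⊔ˡ M₁ M₂ M≤n))
          (q m n (≤⊔ʳ M₁ M₂ M≤m) (≤⊔ʳ M₁ M₂ M≤n)))

open CauchyLemmas

_+ᴿ_ _*ᴿ_ : ℝ → ℝ → ℝ
x +ᴿ y = mkℝ (λ n → seq x n ℚ.+ seq y n) (+-cauchy (seq x) (seq y) (cauchy x) (cauchy y))
x *ᴿ y = mkℝ (λ n → seq x n ℚ.* seq y n) (*-cauchy (seq x) (seq y) (cauchy x) (cauchy y))

-ᴿ_ : ℝ → ℝ
-ᴿ x = mkℝ (λ n → ℚ.- seq x n) (neg-cauchy (seq x) (cauchy x))

_-ᴿ_ : ℝ → ℝ → ℝ
x -ᴿ y = x +ᴿ (-ᴿ y)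

∑ : ∀ {n} → Vector ℝ n → ℝ
∑ = foldr _+ᴿ_ 0ᴿ

-- Determines s up to _≃_.
IsSqrt : ℝ → ℝ → Set
IsSqrt x s = 0ᴿ ≤ᴿ s × s *ᴿ s ≃ x

------------------------------------------------------------------------
-- Eigenvalues of real square matrices

Matrix : ℕ → Set
Matrix n = Fin n → Fin n → ℝ

IsEigenvalue : ∀ {n} → Matrix n → ℝ → Set
IsEigenvalue {n} M μ = Σ[ x ∈ Vector ℝ n ]
  ( ¬ (∀ i → x i ≃ 0ᴿ)
  × (∀ i → ∑ (λ j → M i j *ᴿ x j) ≃ μ *ᴿ x i))

IsLargestEigenvalue : ∀ {n} → Matrix n → ℝ → Set
IsLargestEigenvalue M μ =
  IsEigenvalue M μ × (∀ ν → IsEigenvalue M ν → ν ≤ᴿ μ)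

------------------------------------------------------------------------
-- Finite simple graphs of order n

record Graph (n : ℕ) : Set where
  field
    adj     : Fin n → Fin n → Bool
    adj-sym : ∀ u v → adj u v ≡ adj v u
    irrefl  : ∀ v → adj v v ≡ false

open Graph public

module _ {n : ℕ} (G : Graph n) where

  Adj : Fin n → Fin n → Set
  Adj u v = T (adj G u v)

  neighbours : Fin n → Subset n
  neighbours v = Vec.tabulate (adj G v)

  degree : Fin n → ℕ
  degree v = ∣ neighbours v ∣

  HasMinDegree : ℕ → Set
  HasMinDegree δ = (∀ v → δ ℕ.≤ degree v) × ∃[ v ] degree v ≡ δ

  Connected : Set
  Connected = ∀ u v → Star Adj u v

  adjacencyMatrix : Matrix n
  adjacencyMatrix i j = if adj G i j then 1ᴿ else 0ᴿ

  degreeMatrix : Matrix n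
  degreeMatrix i j = if ⌊ i ≟F j ⌋ then fromℕ (degree i) else 0ᴿ

  A[_] : ℝ → Matrix n
  A[ α ] i j = α *ᴿ degreeMatrix i j +ᴿ (1ᴿ -ᴿ α) *ᴿ adjacencyMatrix i j

  Is-α-SpectralRadius : ℝ → ℝ → Set
  Is-α-SpectralRadius α μ = IsLargestEigenvalue A[ α ] μ

  -- A path is given by its sequence of (pairwise distinct) vertices.
  IsPath : Fin n → Fin n → List (Fin n) → Set
  IsPath u v p = head p ≡ just u × last p ≡ just v × Linked Adj p × Unique p

  -- The set {v₁,…,v_t} is given by an injective enumeration v.
  OneToManyDisjointPathCoverable : ℕ → Set
  OneToManyDisjointPathCoverable t =
    ∀ (u : Fin n) (v : Fin t → Fin n) →
    Injective _≡_ _≡_ v → (∀ i → v i ≢ u) →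
    Σ[ P ∈ (Fin t → List (Fin n)) ]
      ( (∀ i → IsPath u (v i) (P i))
      × (∀ w → ∃[ i ] w ∈ P i)
      × (∀ i j → i ≢ j → ∀ w → w ∈ P i → w ∈ P j → w ≡ u))

------------------------------------------------------------------------
-- The edge bounds.  When 2 ≤ t, t + 1 ≤ δ and δ ≤ ⌊(n+t-2)/2⌋ no
-- subtraction below is truncated.

maxδ : ℕ → ℕ → ℕ
maxδ n t = (n ℕ.+ t ℕ.∸ 2) ℕ./ 2

f₁ : ℕ → ℕ → ℕ → ℕ
f₁ n t δ = (n ℕ.+ t ℕ.∸ δ ℕ.∸ 1) C 2 ℕ.+ (δ ℕ.∸ t ℕ.+ 1) ℕ.* δ

g₁ : ℕ → ℕ → ℕ → ℕ
g₁ n t δ = (n ℕ.+ t ℕ.∸ h ℕ.∸ 1) C 2 ℕ.+ (h ℕ.∸ t) ℕ.* h ℕ.+ δ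
  where
  h : ℕ
  h = maxδ n t

h₁ : ℕ → ℕ → ℕ → ℕ
h₁ n t δ = f₁ n t δ ℕ.⊔ g₁ n t δ

{-# OPTIONS --safe #-}

-- Spectral part: let B = A_α(G), let x be an eigenvector for λ, y = |x|, and let b, c be such that
-- the bound of the theorem is the larger root of X² - bX - c.  Then B y ≥ λ y coordinatewise, and
-- bounding the degree sum over the neighbours of a vertex through the minimum degree gives
-- 1ᵀB²y ≤ b 1ᵀB y + c 1ᵀy whenever the degree sum is at most 2 h₁; so λ² - bλ ≤ c, with y in the
-- role of a Perron vector.  Hence the degree sum of G exceeds 2 h₁.
--
-- Combinatorial part: if x, y are nonadjacent with d(x) + d(y) ≥ n + t - 1, a cover of G + xy that
-- uses xy can be rerouted, by a Bondy–Chvátal crossing, to a cover of G.  If every nonadjacent pair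
-- violated this inequality, then for some δ ≤ k ≤ ⌊(n+t-2)/2⌋ more than k - t vertices would have
-- degree at most k; the degree sum would then be at most twice a convex function of k whose values
-- at the two ends of the range are f₁ and g₁.  Adding edges keeps the degree sequence large, so one
-- ends at the complete graph.

module Submission where

open import Defs
open import Algebra.Bundles using (CommutativeRing)
open import Data.Bool.Base using (Bool; true; false; T; not; _∧_; _∨_; if_then_else_)
import Data.Bool.Properties as Bool
open import Data.Empty using (⊥; ⊥-elim)
open import Data.Fin.Base using (Fin; zero; suc)
import Data.Fin.Properties as FinP
open import Data.Fin.Properties using (_≟_)
open import Data.Fin.Subset using (∣_∣)
import Data.Integer.Base as ℤ
import Data.Integer.Properties as ℤP
open import Data.List.Base using (List; []; _∷_; _++_; last; tabulate; filterᵇ; [_])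
open import Data.List.Membership.Propositional using (_∈_)
open import Data.List.Relation.Unary.All using (All; []; _∷_)
open import Data.List.Relation.Unary.AllPairs using ([]; _∷_)
open import Data.List.Relation.Unary.Any using (here; there)
open import Data.List.Relation.Unary.Linked using (Linked; [-]; _∷_)
open import Data.List.Relation.Unary.Unique.Propositional using (Unique)
open import Data.Maybe.Base using (just)
open import Data.Nat.Base as ℕ using (ℕ; zero; suc; _≤_; _<_; _+_; _*_; _∸_; _/_; _%_; _⊔_; z≤n; s≤s)
open import Data.Nat.Combinatorics using (_C_; nC1≡n; nCk+nC[k+1]≡[n+1]C[k+1])
open import Data.Nat.DivMod using (m/n*n≤m; m≡m%n+[m/n]*n; m%n<n)
import Data.Nat.Properties as ℕP
open import Data.Nat.Properties using (_≤?_; _<?_; ≤-trans; ≤-refl; ≤-reflexive)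
open import Data.Nat.Solver using (module +-*-Solver)
open import Data.Product.Base using (_×_; _,_; ∃-syntax; proj₁; proj₂)
open import Data.Rational.Base as ℚ using (ℚ; 0ℚ; 1ℚ; ½)
import Data.Rational.Properties as ℚP
import Data.Rational.Solver as ℚS
import Data.Rational.Unnormalised.Base as ℚᵘ
import Data.Rational.Unnormalised.Properties as ℚᵘP
open import Data.Sum.Base using (_⊎_; inj₁; inj₂)
import Data.Vec.Base as Vec
open import Function.Base using (_∘_; case_of_)
open import Function.Definitions using (Injective)
open import Relation.Binary.PropositionalEquality
  using (_≡_; _≢_; refl; sym; trans; cong; cong₂; subst; subst₂; module ≡-Reasoning)
open import Relation.Nullary using (¬_; Dec; yes; no; contradiction)
open import Relation.Nullary.Decidable using (⌊_⌋; _×-dec_; ¬?; decidable-stable)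

open import Algebra.Properties.Semiring.Sum ℕP.+-*-semiring
  using (sum; sum-cong-≗; ∑-distrib-+; ∑-comm; *-distribˡ-sum; *-distribʳ-sum)
open import Algebra.Properties.Semiring.Sum (CommutativeRing.semiring ℚP.+-*-commutativeRing)
  using () renaming (sum to sumℚ; sum-cong-≗ to sumℚ-cong; ∑-distrib-+ to sumℚ-distrib-+;
    ∑-comm to sumℚ-comm; *-distribˡ-sum to *-distribˡ-sumℚ; *-distribʳ-sum to *-distribʳ-sumℚ)

-- Constructive reals shape the spectral half: the sign of a real coordinate or factor cannot be
-- decided, and no Perron vector is at hand. So |x| is taken for the eigenvector x that the
-- hypothesis supplies, and the inequalities are combined in an identity between rationals, valid at
-- each index of the Cauchy sequences, one side of which is a sum of products of asymptotically
-- nonnegative terms. The combinatorial estimates enter it through natural-number slacks. The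
-- coefficient b is α(n - 1) + (1 - α)(δ - 1): its first part comes from degrees being at most n -
-- 1, its second from nonneighbours having degree at least δ.
--
-- In the combinatorial half, a cover records walks together with the total of an arbitrary weight
-- over its routes, so disjointness, vertex counts and degrees are instances of one equation and a
-- rerouting is checked by arithmetic. The threshold n + t - 1 arises as follows: without a
-- crossing, the n - 1 vertices other than u allow a degree sum of n - 1, and each of the t - 1
-- unbroken paths allows 1 more because of its last vertex.

private variable
  n t : ℕ

-- Finite sums and counts of natural numbers

ι : Bool → ℕ
ι b = if b then 1 else 0

ι≤1 : ∀ b → ι b ≤ 1
ι≤1 true  = ≤-refl
ι≤1 false = z≤n

ι-yes : ∀ {p} {P : Set p} (d : Dec P) → P → ι ⌊ d ⌋ ≡ 1
ι-yes (yes _) _ = refl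
ι-yes (no ¬p) p = contradiction p ¬p

ι-no : ∀ {p} {P : Set p} (d : Dec P) → ¬ P → ι ⌊ d ⌋ ≡ 0
ι-no (yes p) ¬p = contradiction p ¬p
ι-no (no _)  _  = refl

≤-transfer : ∀ {x y l r} → l ≤ r → x + r ≤ y + l → x ≤ y
≤-transfer {x} {y} {l} {r} l≤r eq =
  ℕP.+-cancelʳ-≤ r x y (≤-trans eq (ℕP.+-monoʳ-≤ y l≤r))

sum-mono : {f g : Fin n → ℕ} → (∀ i → f i ≤ g i) → sum f ≤ sum g
sum-mono {zero}  f≤g = z≤n
sum-mono {suc n} f≤g = ℕP.+-mono-≤ (f≤g zero) (sum-mono (f≤g ∘ suc))

sum-const : ∀ n c → sum {n} (λ _ → c) ≡ n * c
sum-const zero    c = refl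
sum-const (suc n) c = cong (c +_) (sum-const n c)

sum-zero : {f : Fin n → ℕ} → (∀ i → f i ≡ 0) → sum f ≡ 0
sum-zero {n} f≡0 = trans (sum-cong-≗ f≡0) (trans (sum-const n 0) (ℕP.*-zeroʳ n))

sum-single : {f : Fin n → ℕ} (i : Fin n) → (∀ j → j ≢ i → f j ≡ 0) → sum f ≡ f i
sum-single {f = f} zero h =
  trans (cong (f zero +_) (sum-zero λ j → h (suc j) λ ())) (ℕP.+-identityʳ _)
sum-single (suc i) h =
  cong₂ _+_ (h zero λ ()) (sum-single i λ j j≢i → h (suc j) (j≢i ∘ FinP.suc-injective))

term≤sum : (f : Fin n → ℕ) (i : Fin n) → f i ≤ sum f
term≤sum f zero    = ℕP.m≤m+n _ _
term≤sum f (suc i) = ≤-trans (term≤sum (f ∘ suc) i) (ℕP.m≤n+m _ (f zero))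

twoTerms≤sum : (f : Fin n → ℕ) (i j : Fin n) → i ≢ j → f i + f j ≤ sum f
twoTerms≤sum f zero    zero    i≢j = contradiction refl i≢j
twoTerms≤sum f zero    (suc j) _   = ℕP.+-monoʳ-≤ (f zero) (term≤sum (f ∘ suc) j)
twoTerms≤sum f (suc i) zero    _   = ≤-trans (≤-reflexive (ℕP.+-comm (f (suc i)) (f zero)))
  (ℕP.+-monoʳ-≤ (f zero) (term≤sum (f ∘ suc) i))
twoTerms≤sum f (suc i) (suc j) i≢j =
  ≤-trans (twoTerms≤sum (f ∘ suc) i j (i≢j ∘ cong suc)) (ℕP.m≤n+m _ (f zero))

sum-positive : (f : Fin n → ℕ) → 1 ≤ sum f → ∃[ i ] 1 ≤ f i
sum-positive {suc n} f 1≤ with f zero in eq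
... | suc _ = zero , subst (1 ≤_) (sym eq) (s≤s z≤n)
... | zero  with sum-positive (f ∘ suc) 1≤
... | i , p = suc i , p

sum-indicator : (w : Fin n) (c : Fin n → ℕ) → sum (λ i → ι ⌊ i ≟ w ⌋ * c i) ≡ c w
sum-indicator w c =
  trans (sum-single w λ j j≢w → cong (_* c j) (ι-no (j ≟ w) j≢w))
        (trans (cong (_* c w) (ι-yes (w ≟ w) refl)) (ℕP.*-identityˡ (c w)))

sum-⌊≟⌋ : (w : Fin n) → sum (λ i → ι ⌊ i ≟ w ⌋) ≡ 1
sum-⌊≟⌋ w = trans (sum-single w λ j → ι-no (j ≟ w)) (ι-yes (w ≟ w) refl)

∣tabulate∣ : (p : Fin n → Bool) → ∣ Vec.tabulate p ∣ ≡ sum (ι ∘ p)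
∣tabulate∣ {zero}  p = refl
∣tabulate∣ {suc n} p with p zero
... | true  = cong suc (∣tabulate∣ (p ∘ suc))
... | false = ∣tabulate∣ (p ∘ suc)

thin : (p : Fin n → Bool) (ℓ : ℕ) → ℓ ≤ sum (ι ∘ p) →
       ∃[ q ] (∀ i → T (q i) → T (p i)) × sum (ι ∘ q) ≡ ℓ
thin {n} p zero _  = (λ _ → false) , (λ _ ()) , sum-zero {n} (λ _ → refl)
thin {suc n} p (suc ℓ) ℓ≤ with p zero in eq
thin {suc n} p (suc ℓ) (s≤s ℓ≤) | true with thin (p ∘ suc) ℓ ℓ≤
... | q , q⊆p , ∣q∣ = (λ { zero → true ; (suc i) → q i })
    , (λ { zero _ → subst T (sym eq) _ ; (suc i) → q⊆p i }) , cong suc ∣q∣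
thin {suc n} p (suc ℓ) ℓ≤ | false with thin (p ∘ suc) (suc ℓ) ℓ≤
... | q , q⊆p , ∣q∣ = (λ { zero → false ; (suc i) → q i })
    , (λ { zero () ; (suc i) → q⊆p i }) , ∣q∣

argmax : {P : Fin n → Set} (P? : ∀ i → Dec (P i)) (f : Fin n → ℕ) → ∃[ i ] P i →
         ∃[ i ] P i × (∀ j → P j → f j ≤ f i)
argmax {suc n} {P} P? f (i₀ , p₀) with FinP.any? (P? ∘ suc)
... | no none = zero , only i₀ p₀ , λ { zero _ → ≤-refl ; (suc j) pj → contradiction (j , pj) none }
  where
  only : ∀ i → P i → P zero
  only zero    p = p
  only (suc i) p = contradiction (i , p) none
... | yes some with argmax (P? ∘ suc) (f ∘ suc) some | P? zero
... | i , pi , max | no ¬p0 =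
  suc i , pi , λ { zero p0 → contradiction p0 ¬p0 ; (suc j) pj → max j pj }
... | i , pi , max | yes p0 with ℕP.≤-total (f zero) (f (suc i))
... | inj₁ 0≤i = suc i , pi , λ { zero _ → 0≤i ; (suc j) pj → max j pj }
... | inj₂ i≤0 = zero , p0 , λ { zero _ → ≤-refl ; (suc j) pj → ≤-trans (max j pj) i≤0 }

2*[mC2] : ∀ m → 2 * (m C 2) + m ≡ m * m
2*[mC2] zero    = refl
2*[mC2] (suc m) = begin
  2 * (suc m C 2) + suc m          ≡⟨ cong (λ z → 2 * z + suc m) (nCk+nC[k+1]≡[n+1]C[k+1] m 1) ⟨
  2 * (m C 1 + m C 2) + suc m      ≡⟨ cong (λ z → 2 * (z + m C 2) + suc m) (nC1≡n m) ⟩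
  2 * (m + m C 2) + suc m          ≡⟨ solve 2 (λ m c → con 2 :* (m :+ c) :+ (con 1 :+ m)
                                        := con 2 :* c :+ m :+ (con 2 :* m :+ con 1)) refl m (m C 2) ⟩
  2 * (m C 2) + m + (2 * m + 1)    ≡⟨ cong (_+ (2 * m + 1)) (2*[mC2] m) ⟩
  m * m + (2 * m + 1)              ≡⟨ solve 1 (λ m → m :* m :+ (con 2 :* m :+ con 1)
                                        := (con 1 :+ m) :* (con 1 :+ m)) refl m ⟩
  suc m * suc m                    ∎
  where open ≡-Reasoning
        open +-*-Solver

-- Degree sums

module Degrees (G : Graph n) where

  edge : Fin n → Fin n → ℕ
  edge i j = ι (adj G i j)

  d : Fin n → ℕ
  d = degree G

  degreeSum : ℕ
  degreeSum = sum d

  lowCount : ℕ → ℕ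
  lowCount k = sum (λ i → ι ⌊ d i ≤? k ⌋)

  degree≡sum : ∀ i → d i ≡ sum (edge i)
  degree≡sum i = ∣tabulate∣ (adj G i)

  edge-sym : ∀ i j → edge i j ≡ edge j i
  edge-sym i j = cong ι (adj-sym G i j)

  degreeSum≤ : degreeSum ≤ n * n
  degreeSum≤ = ≤-trans (sum-mono {n = n} λ i → ≤-trans (≤-reflexive (degree≡sum i))
      (≤-trans (sum-mono {n = n} λ j → ι≤1 (adj G i j)) (≤-reflexive (trans (sum-const n 1) (ℕP.*-identityʳ n)))))
    (≤-reflexive (sum-const n n))

  sum-rows : (p : Fin n → ℕ) → sum (λ i → sum λ j → p i * edge i j) ≡ sum (λ i → p i * d i)
  sum-rows p = sum-cong-≗ λ i → trans (sym (*-distribˡ-sum (p i) (edge i))) (cong (p i *_) (sym (degree≡sum i)))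

  -- Every edge inside the complement of L counts in m * m; all others have an endpoint in L.
  degreeSum-split : (L : Fin n → Bool) → let m = sum (λ i → ι (not (L i))) in
    degreeSum + m ≤ 2 * sum (λ i → ι (L i) * d i) + m * m
  degreeSum-split L = begin
      degreeSum + m
        ≡⟨ cong₂ _+_ (sum-cong-≗ degree≡sum) (sum-cong-≗ λ i → sym (sum-indicator i (λ _ → l′ i))) ⟩
      sum (λ i → sum (edge i)) + sum (λ i → sum λ j → ι ⌊ j ≟ i ⌋ * l′ i)
        ≡⟨ ∑-distrib-+ (λ i → sum (edge i)) _ ⟨
      sum (λ i → sum (edge i) + sum λ j → ι ⌊ j ≟ i ⌋ * l′ i)
        ≡⟨ sum-cong-≗ (λ i → sym (∑-distrib-+ (edge i) _)) ⟩
      sum (λ i → sum λ j → edge i j + ι ⌊ j ≟ i ⌋ * l′ i)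
        ≤⟨ sum-mono (λ i → sum-mono (pointwise i)) ⟩
      sum (λ i → sum λ j → l i * edge i j + l j * edge j i + l′ i * l′ j)
        ≡⟨ sum-cong-≗ (λ i → trans (∑-distrib-+ (λ j → l i * edge i j + l j * edge j i) _)
                               (cong (_+ sum (λ j → l′ i * l′ j)) (∑-distrib-+ (λ j → l i * edge i j) _))) ⟩
      sum (λ i → sum (λ j → l i * edge i j) + sum (λ j → l j * edge j i) + sum (λ j → l′ i * l′ j))
        ≡⟨ trans (∑-distrib-+ (λ i → sum (λ j → l i * edge i j) + sum (λ j → l j * edge j i)) _)
             (cong (_+ sum (λ i → sum λ j → l′ i * l′ j)) (∑-distrib-+ (λ i → sum (λ j → l i * edge i j)) _)) ⟩
      sum (λ i → sum (λ j → l i * edge i j)) + sum (λ i → sum (λ j → l j * edge j i)) + sum (λ i → sum (λ j → l′ i * l′ j))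
        ≡⟨ cong₂ _+_ (cong₂ _+_ (sum-rows l) (trans (∑-comm (λ i j → l j * edge j i)) (sum-rows l))) square ⟩
      S + S + m * m
        ≡⟨ cong (λ z → S + z + m * m) (sym (ℕP.+-identityʳ S)) ⟩
      2 * S + m * m ∎
    where
    open ℕP.≤-Reasoning
    l l′ : Fin n → ℕ
    l i = ι (L i)
    l′ i = ι (not (L i))
    m S : ℕ
    m = sum l′
    S = sum (λ i → l i * d i)
    square : sum (λ i → sum (λ j → l′ i * l′ j)) ≡ m * m
    square = trans (sum-cong-≗ λ i → sym (*-distribˡ-sum (l′ i) l′)) (sym (*-distribʳ-sum m l′))
    pointwise : ∀ i j → edge i j + ι ⌊ j ≟ i ⌋ * l′ i ≤ l i * edge i j + l j * edge j i + l′ i * l′ j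
    pointwise i j with j ≟ i
    pointwise i j | yes refl rewrite irrefl G i with L i
    ... | true  = z≤n
    ... | false = ≤-refl
    pointwise i j | no _ rewrite adj-sym G j i with adj G i j | L i | L j
    ... | false | _     | _     = z≤n
    ... | true  | true  | _     = s≤s z≤n
    ... | true  | false | true  = s≤s z≤n
    ... | true  | false | false = s≤s z≤n

  -- The set `L` that splits the degree sum consists of `w` and ℓ further vertices of degree at most
  -- k, so one of the ℓ + 1 low degrees is charged δ instead of k. This saving is the origin of the
  -- summand δ in `g₁`.
  manyLow⇒fewEdges : ∀ {δ k ℓ m} (w : Fin n) → d w ≡ δ → δ ≤ k →
    suc ℓ ≤ lowCount k → m + suc ℓ ≡ n →
    degreeSum + m ≤ 2 * (δ + ℓ * k) + m * m
  manyLow⇒fewEdges {δ} {k} {ℓ} {m} w dw δ≤k ℓ< m+ℓ = begin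
      degreeSum + m           ≡⟨ cong (degreeSum +_) m≡ ⟩
      degreeSum + m′          ≤⟨ degreeSum-split L ⟩
      2 * S + m′ * m′         ≤⟨ ℕP.+-monoˡ-≤ (m′ * m′) (ℕP.*-monoʳ-≤ 2 S≤) ⟩
      2 * (δ + ℓ * k) + m′ * m′ ≡⟨ cong (λ z → 2 * (δ + ℓ * k) + z * z) (sym m≡) ⟩
      2 * (δ + ℓ * k) + m * m ∎
    where
    open ℕP.≤-Reasoning
    p : Fin n → Bool
    p i = ⌊ d i ≤? k ⌋ ∧ not ⌊ i ≟ w ⌋
    p-card : ℓ ≤ sum (ι ∘ p)
    p-card = ℕP.+-cancelˡ-≤ 1 _ _ (≤-trans ℓ< (≤-trans (sum-mono split)
               (≤-reflexive (trans (∑-distrib-+ (λ i → ι ⌊ i ≟ w ⌋) _) (cong (_+ sum (ι ∘ p)) (sum-⌊≟⌋ w))))))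
      where
      split : ∀ i → ι ⌊ d i ≤? k ⌋ ≤ ι ⌊ i ≟ w ⌋ + ι (p i)
      split i with d i ≤? k | i ≟ w
      ... | yes _ | yes _ = s≤s z≤n
      ... | yes _ | no _  = s≤s z≤n
      ... | no _  | _     = z≤n
    -- Exactly ℓ vertices are kept, so that the complement of `L` has exactly m elements however
    -- many low vertices there are.
    chosen = thin p ℓ p-card
    q = proj₁ chosen
    q⊆p = proj₁ (proj₂ chosen)
    ∣q∣ = proj₂ (proj₂ chosen)
    L : Fin n → Bool
    L i = ⌊ i ≟ w ⌋ ∨ q i
    m′ S : ℕ
    m′ = sum (λ i → ι (not (L i)))
    S = sum (λ i → ι (L i) * d i)
    partition : ∀ i → ι (not (L i)) + (ι ⌊ i ≟ w ⌋ + ι (q i)) ≡ 1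
    partition i with i ≟ w | d i ≤? k | q i | q⊆p i
    ... | yes _ | yes _ | true  | q⇒p = ⊥-elim (q⇒p _)
    ... | yes _ | no _  | true  | q⇒p = ⊥-elim (q⇒p _)
    ... | no _  | _     | true  | _   = refl
    ... | yes _ | _     | false | _   = refl
    ... | no _  | _     | false | _   = refl
    m≡ : m ≡ m′
    m≡ = ℕP.+-cancelʳ-≡ (suc ℓ) m m′ (≡.begin
      m + suc ℓ ≡.≡⟨ m+ℓ ⟩
      n ≡.≡⟨ trans (sum-const n 1) (ℕP.*-identityʳ n) ⟨
      sum {n} (λ _ → 1) ≡.≡⟨ sum-cong-≗ (sym ∘ partition) ⟩
      sum (λ i → ι (not (L i)) + (ι ⌊ i ≟ w ⌋ + ι (q i)))
        ≡.≡⟨ trans (∑-distrib-+ (λ i → ι (not (L i))) _)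
               (cong (m′ +_) (trans (∑-distrib-+ (λ i → ι ⌊ i ≟ w ⌋) _) (cong₂ _+_ (sum-⌊≟⌋ w) ∣q∣))) ⟩
      m′ + suc ℓ ≡.∎)
      where module ≡ = ≡-Reasoning
    S≤ : S ≤ δ + ℓ * k
    S≤ = begin
      S ≤⟨ sum-mono pointwise ⟩
      sum (λ i → ι ⌊ i ≟ w ⌋ * δ + ι (q i) * k) ≡⟨ ∑-distrib-+ (λ i → ι ⌊ i ≟ w ⌋ * δ) _ ⟩
      sum (λ i → ι ⌊ i ≟ w ⌋ * δ) + sum (λ i → ι (q i) * k)
        ≡⟨ cong₂ _+_ (sum-indicator w (λ _ → δ))
             (trans (sym (*-distribʳ-sum k (ι ∘ q))) (cong (_* k) ∣q∣)) ⟩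
      δ + ℓ * k ∎
      where
      pointwise : ∀ i → ι (L i) * d i ≤ ι ⌊ i ≟ w ⌋ * δ + ι (q i) * k
      pointwise i with i ≟ w | d i ≤? k | q i | q⊆p i
      ... | yes refl | _ | _ | _ = ≤-trans (≤-reflexive (cong (_+ 0) dw)) (ℕP.m≤m+n _ _)
      ... | no _ | _ | false | _ = z≤n
      ... | no _ | yes d≤k | true | _ = ℕP.+-monoˡ-≤ 0 d≤k
      ... | no _ | no _ | true | q⇒p = ⊥-elim (q⇒p _)

-- In its use e = δ - t and M + b = n + t - k - 1, so the bound on D is φ(k) = 2(δ + (k - t)k) + m(m
-- - 1) with m = n + t - k - 1, while F = φ(δ) and H = φ(h). As φ is quadratic in k with leading
-- coefficient 3, bφ(δ) + aφ(h) = (a + b)φ(k) + 3ab(a + b). Each hypothesis has its m on the left,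
-- which avoids subtraction.
convexity : ∀ {D F H M a b e δ k h} →
  k ≡ δ + a → h ≡ δ + a + b →
  D + (M + b) ≤ 2 * (δ + (e + a) * k) + (M + b) * (M + b) →
  F + (M + b + a) ≡ (M + b + a) * (M + b + a) + 2 * ((e + 1) * δ) →
  H + M ≡ M * M + 2 * ((e + a + b) * h + δ) →
  D ≤ F ⊔ H
-- Here k = δ and the bound is F itself; a + b may be zero, so the weighted inequality could not be
-- divided by it.
convexity {D} {F} {H} {M} {zero} {b} {e} {δ} refl refl D≤ F≡ H≡ =
  ≤-trans (≤-transfer D≤ (≤-reflexive eq)) (ℕP.m≤m⊔n F H)
  where
  open +-*-Solver
  X = 2 * (δ + (e + 0) * (δ + 0)) + (M + b) * (M + b)
  eq : D + X ≡ F + (D + (M + b))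
  eq = trans (cong (D +_) (trans (solve 4 (λ M b e δ →
           con 2 :* (δ :+ (e :+ con 0) :* (δ :+ con 0)) :+ (M :+ b) :* (M :+ b)
           := (M :+ b :+ con 0) :* (M :+ b :+ con 0) :+ con 2 :* ((e :+ con 1) :* δ)) refl M b e δ)
         (sym F≡)))
       (solve 4 (λ D F M b → D :+ (F :+ (M :+ b :+ con 0)) := F :+ (D :+ (M :+ b))) refl D F M b)
convexity {D} {F} {H} {M} {a@(suc _)} {b} {e} {δ} refl refl D≤ F≡ H≡ =
  ℕP.*-cancelˡ-≤ (a + b) (≤-trans weighted (≤-trans
    (ℕP.+-mono-≤ (ℕP.*-monoʳ-≤ b (ℕP.m≤m⊔n F H)) (ℕP.*-monoʳ-≤ a (ℕP.m≤n⊔m F H)))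
    (≤-reflexive (trans (sym (ℕP.*-distribʳ-+ (F ⊔ H) b a)) (cong (_* (F ⊔ H)) (ℕP.+-comm b a))))))
  where
  open +-*-Solver
  X Y Z : ℕ
  X = 2 * (δ + (e + a) * (δ + a)) + (M + b) * (M + b)
  Y = (M + b + a) * (M + b + a) + 2 * ((e + 1) * δ)
  Z = M * M + 2 * ((e + a + b) * (δ + a + b) + δ)
  Y+Z : b * Y + a * Z ≡ (a + b) * X + 3 * (a * b * (a + b))
  Y+Z = solve 5 (λ M a b e δ →
    b :* ((M :+ b :+ a) :* (M :+ b :+ a) :+ con 2 :* ((e :+ con 1) :* δ))
    :+ a :* (M :* M :+ con 2 :* ((e :+ a :+ b) :* (δ :+ a :+ b) :+ δ))
    := (a :+ b) :* (con 2 :* (δ :+ (e :+ a) :* (δ :+ a)) :+ (M :+ b) :* (M :+ b))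
    :+ con 3 :* (a :* b :* (a :+ b))) refl M a b e δ
  weighted : (a + b) * D ≤ b * F + a * H
  weighted = ≤-transfer (ℕP.*-monoʳ-≤ (a + b) D≤) (begin
    (a + b) * D + (a + b) * X
      ≤⟨ ℕP.m≤m+n _ (3 * (a * b * (a + b))) ⟩
    (a + b) * D + (a + b) * X + 3 * (a * b * (a + b))
      ≡⟨ ℕP.+-assoc ((a + b) * D) _ _ ⟩
    (a + b) * D + ((a + b) * X + 3 * (a * b * (a + b)))
      ≡⟨ cong ((a + b) * D +_) (sym Y+Z) ⟩
    (a + b) * D + (b * Y + a * Z)
      ≡⟨ cong₂ (λ y z → (a + b) * D + (b * y + a * z)) (sym F≡) (sym H≡) ⟩
    (a + b) * D + (b * (F + (M + b + a)) + a * (H + M))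
      ≡⟨ solve 6 (λ a b D F M H →
           (a :+ b) :* D :+ (b :* (F :+ (M :+ b :+ a)) :+ a :* (H :+ M))
           := b :* F :+ a :* H :+ (a :+ b) :* (D :+ (M :+ b))) refl a b D F M H ⟩
    b * F + a * H + (a + b) * (D + (M + b)) ∎)
    where open ℕP.≤-Reasoning

-- Low-degree counts and nonadjacent pairs of large degree sum

sum-mono-< : {f g : Fin n → ℕ} (i : Fin n) → (∀ j → f j ≤ g j) → f i < g i → sum f < sum g
sum-mono-< {f = f} {g} zero    f≤g f<g = ℕP.+-mono-<-≤ f<g (sum-mono (f≤g ∘ suc))
sum-mono-< {f = f} {g} (suc i) f≤g f<g = ℕP.+-mono-≤-< (f≤g zero) (sum-mono-< i (f≤g ∘ suc) f<g)

-- The minimum degree enters as a lower bound only: this survives the addition of edges, whereas an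
-- attained minimum as in `HasMinDegree` need not.
FewLow : Graph n → (t δ h : ℕ) → Set
FewLow G t δ h = (∀ v → δ ≤ degree G v) × (∀ k → δ ≤ k → k ≤ h → Degrees.lowCount G k + t ≤ k)

-- Writing δ = t + e, k = δ + a, h = k + b and n + t = h + 1 + M gives every truncated subtraction
-- in `f₁` and `g₁` an exact value; M is the upper entry of the binomial coefficient in `g₁`.
manyLow⇒sparse : ∀ (G : Graph n) {t e a b M} (w : Fin n) → degree G w ≡ t + e →
  maxδ n t ≡ t + e + a + b → suc (t + e + a + b) + M ≡ n + t →
  suc (t + e + a) ≤ Degrees.lowCount G (t + e + a) + t →
  Degrees.degreeSum G ≤ 2 * h₁ n t (t + e)
manyLow⇒sparse {n} G {t} {e} {a} {b} {M} w dw h≡ M≡ many = subst (degreeSum ≤_)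
    (sym (ℕP.*-distribˡ-⊔ 2 (f₁ n t (t + e)) (g₁ n t (t + e))))
    (convexity {a = a} {b} {e} {t + e} refl refl
      (manyLow⇒fewEdges w dw (ℕP.m≤m+n _ a) many′ size) F≡ H≡)
  where
  open Degrees G
  open +-*-Solver
  many′ : suc (e + a) ≤ lowCount (t + e + a)
  many′ = ≤-transfer many (≤-reflexive (solve 4 (λ t e a c →
    con 1 :+ (e :+ a) :+ (c :+ t) := c :+ (con 1 :+ (t :+ e :+ a))) refl t e a (lowCount (t + e + a))))
  size : M + b + suc (e + a) ≡ n
  size = ℕP.+-cancelʳ-≡ t _ n (trans (solve 5 (λ M b e a t →
    M :+ b :+ (con 1 :+ (e :+ a)) :+ t := con 1 :+ (t :+ e :+ a :+ b) :+ M) refl M b e a t) M≡)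
  ∸-value : ∀ {m} c → suc m + c ≡ n + t → n + t ∸ m ∸ 1 ≡ c
  ∸-value {m} c eq = trans (ℕP.∸-+-assoc (n + t) m 1) (trans (cong₂ _∸_ (sym eq) (ℕP.+-comm m 1)) (ℕP.m+n∸m≡n (suc m) c))
  F≡ : 2 * f₁ n t (t + e) + (M + b + a) ≡ (M + b + a) * (M + b + a) + 2 * ((e + 1) * (t + e))
  F≡ rewrite ∸-value {t + e} (M + b + a) (trans (solve 5 (λ M b e a t →
        con 1 :+ (t :+ e) :+ (M :+ b :+ a) := con 1 :+ (t :+ e :+ a :+ b) :+ M) refl M b e a t) M≡)
    | ℕP.m+n∸m≡n t e
    = trans (solve 3 (λ c m x → con 2 :* (c :+ x) :+ m := con 2 :* c :+ m :+ con 2 :* x)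
               refl ((M + b + a) C 2) (M + b + a) ((e + 1) * (t + e)))
        (cong (_+ 2 * ((e + 1) * (t + e))) (2*[mC2] (M + b + a)))
  H≡ : 2 * g₁ n t (t + e) + M ≡ M * M + 2 * ((e + a + b) * (t + e + a + b) + (t + e))
  H≡ rewrite h≡ | ∸-value {t + e + a + b} M M≡
    | trans (cong (_∸ t) (trans (ℕP.+-assoc (t + e) a b)
        (solve 4 (λ t e a b → t :+ e :+ (a :+ b) := t :+ (e :+ a :+ b)) refl t e a b))) (ℕP.m+n∸m≡n t (e + a + b))
    = trans (solve 4 (λ c m x δ → con 2 :* (c :+ x :+ δ) :+ m := con 2 :* c :+ m :+ con 2 :* (x :+ δ))
               refl (M C 2) M ((e + a + b) * (t + e + a + b)) (t + e))
        (cong (_+ 2 * ((e + a + b) * (t + e + a + b) + (t + e))) (2*[mC2] M))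

2*maxδ+2≤ : ∀ n t → 2 ≤ t → 2 * maxδ n t + 2 ≤ n + t
2*maxδ+2≤ n t 2≤t = begin
  2 * maxδ n t + 2     ≡⟨ cong (_+ 2) (ℕP.*-comm 2 (maxδ n t)) ⟩
  maxδ n t * 2 + 2     ≤⟨ ℕP.+-monoˡ-≤ 2 (m/n*n≤m (n + t ∸ 2) 2) ⟩
  n + t ∸ 2 + 2        ≡⟨ ℕP.m∸n+n≡m (≤-trans 2≤t (ℕP.m≤n+m t n)) ⟩
  n + t                ∎
  where open ℕP.≤-Reasoning

≤2*maxδ+3 : ∀ n t → 2 ≤ t → n + t ≤ 2 * maxδ n t + 3
≤2*maxδ+3 n t 2≤t = begin
  n + t                               ≡⟨ ℕP.m∸n+n≡m (≤-trans 2≤t (ℕP.m≤n+m t n)) ⟨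
  m + 2                               ≡⟨ cong (_+ 2) (m≡m%n+[m/n]*n m 2) ⟩
  m % 2 + m / 2 * 2 + 2               ≤⟨ ℕP.+-monoˡ-≤ 2 (ℕP.+-monoˡ-≤ (m / 2 * 2) (ℕP.≤-pred (m%n<n m 2))) ⟩
  1 + m / 2 * 2 + 2                   ≡⟨ solve 1 (λ q → con 1 :+ q :* con 2 :+ con 2 := con 2 :* q :+ con 3) refl (m / 2) ⟩
  2 * (m / 2) + 3                     ∎
  where
  open ℕP.≤-Reasoning
  open +-*-Solver
  m = n + t ∸ 2

dense⇒fewLow : ∀ (G : Graph n) {t δ} → 2 ≤ t → t ≤ δ → HasMinDegree G δ →
  2 * h₁ n t δ < Degrees.degreeSum G → FewLow G t δ (maxδ n t)
dense⇒fewLow {n} G {t} {δ} 2≤t t≤δ (δ≤deg , w , dw≡δ) dense =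
  δ≤deg , λ k δ≤k k≤h → decidable-stable (_ ≤? _) λ ¬few → ℕP.<⇒≱ dense (sparse k δ≤k k≤h (ℕP.≰⇒> ¬few))
  where
  room : suc (maxδ n t) ≤ n + t
  room = ≤-trans (ℕP.≤-trans (ℕP.+-monoʳ-≤ 1 (ℕP.m≤m+n (maxδ n t) _))
    (ℕP.≤-trans (ℕP.n≤1+n _) (≤-reflexive (ℕP.+-comm 2 (2 * maxδ n t))))) (2*maxδ+2≤ n t 2≤t)
  sparse : ∀ k → δ ≤ k → k ≤ maxδ n t → k < Degrees.lowCount G k + t → Degrees.degreeSum G ≤ 2 * h₁ n t δ
  sparse k δ≤k k≤h many
    with e , refl ← ℕP.m≤n⇒∃[o]m+o≡n t≤δ
    with a , refl ← ℕP.m≤n⇒∃[o]m+o≡n δ≤k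
    with b , h≡ ← ℕP.m≤n⇒∃[o]m+o≡n k≤h
    with M , M≡ ← ℕP.m≤n⇒∃[o]m+o≡n room
    = manyLow⇒sparse G {b = b} w dw≡δ (sym h≡) (trans (cong (λ z → suc z + M) h≡) M≡) many

-- Let y have maximum degree among the vertices with a nonneighbour, and x maximum degree among the
-- nonneighbours of y. All n - 1 - d(y) nonneighbours of y then have degree at most k = d(x), so a
-- count of at most k - t forces d(x) + d(y) ≥ n + t - 1.
ore-pair : ∀ (G : Graph n) {t δ h} → n + t ≤ 2 * h + 3 → FewLow G t δ h →
  (∀ x y → x ≢ y → adj G x y ≡ true) ⊎
  (∃[ x ] ∃[ y ] x ≢ y × adj G x y ≡ false × n + t ≤ suc (degree G x + degree G y))
ore-pair {n} G {t} {δ} {h} n+t≤ (δ≤deg , few) = result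
  where
  open Degrees G
  NonAdj : Fin n → Fin n → Set
  NonAdj y x = x ≢ y × adj G x y ≡ false
  NonAdj? : ∀ y x → Dec (NonAdj y x)
  NonAdj? y x = ¬? (x ≟ y) ×-dec (adj G x y Bool.≟ false)
  HasNonAdj? : ∀ y → Dec (∃[ x ] NonAdj y x)
  HasNonAdj? y = FinP.any? (NonAdj? y)

  module _ (x y : Fin n) (x≢y : x ≢ y) (dx≤dy : d x ≤ d y)
           (max : ∀ z → NonAdj y z → d z ≤ d x) where
    k = d x
    nonAdj-low : n ≤ lowCount k + d y + 1
    nonAdj-low = begin
      n ≡⟨ trans (sum-const n 1) (ℕP.*-identityʳ n) ⟨
      sum {n} (λ _ → 1) ≤⟨ sum-mono pointwise ⟩
      sum (λ z → ι ⌊ d z ≤? k ⌋ + edge y z + ι ⌊ z ≟ y ⌋)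
        ≡⟨ trans (∑-distrib-+ (λ z → ι ⌊ d z ≤? k ⌋ + edge y z) _)
             (cong₂ _+_ (∑-distrib-+ (λ z → ι ⌊ d z ≤? k ⌋) _) (sum-⌊≟⌋ y)) ⟩
      lowCount k + sum (edge y) + 1 ≡⟨ cong (λ z → lowCount k + z + 1) (degree≡sum y) ⟨
      lowCount k + d y + 1 ∎
      where
      open ℕP.≤-Reasoning
      pointwise : ∀ z → 1 ≤ ι ⌊ d z ≤? k ⌋ + edge y z + ι ⌊ z ≟ y ⌋
      pointwise z with z ≟ y | adj G y z in yz | d z ≤? k
      ... | yes _  | _     | _ = ℕP.m≤n+m 1 _
      ... | no _   | true  | yes _ = s≤s z≤n
      ... | no _   | true  | no _ = s≤s z≤n
      ... | no _   | false | yes _ = s≤s z≤n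
      ... | no z≢y | false | no dz≰k = contradiction (max z (z≢y , trans (adj-sym G z y) yz)) dz≰k

    large : n + t ≤ suc (k + d y)
    large = decidable-stable (_ ≤? _) λ ¬large → impossible (ℕP.≰⇒> ¬large)
      where
      open +-*-Solver
      impossible : suc (k + d y) < n + t → ⊥
      impossible small = ℕP.<-irrefl refl (ℕP.≤-trans small (begin
        n + t                  ≤⟨ ℕP.+-monoˡ-≤ t nonAdj-low ⟩
        lowCount k + d y + 1 + t ≡⟨ solve 3 (λ c d t → c :+ d :+ con 1 :+ t := c :+ t :+ (d :+ con 1)) refl (lowCount k) (d y) t ⟩
        lowCount k + t + (d y + 1) ≤⟨ ℕP.+-monoˡ-≤ (d y + 1) (few k (δ≤deg x) k≤h) ⟩
        k + (d y + 1)          ≡⟨ solve 2 (λ k d → k :+ (d :+ con 1) := con 1 :+ (k :+ d)) refl k (d y) ⟩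
        suc (k + d y)          ∎))
        where
        open ℕP.≤-Reasoning
        -- The count is available only up to h. Were k > h, then d(x) ≤ d(y) would give d(x) + d(y)
        -- ≥ 2h + 2 ≥ n + t - 1, against `small`.
        k≤h : k ≤ h
        k≤h = ℕP.≮⇒≥ λ h<k → ℕP.<-irrefl refl (begin-strict
          2 * h + 3        <⟨ ≤-reflexive (solve 1 (λ h → con 1 :+ (con 2 :* h :+ con 3) := con 2 :+ (con 1 :+ h :+ (con 1 :+ h))) refl h) ⟩
          2 + (suc h + suc h) ≤⟨ ℕP.+-monoʳ-≤ 2 (ℕP.+-mono-≤ h<k h<k) ⟩
          2 + (k + k)      ≤⟨ ℕP.+-monoʳ-≤ 2 (ℕP.+-monoʳ-≤ k dx≤dy) ⟩
          2 + (k + d y)    ≤⟨ small ⟩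
          n + t            ≤⟨ n+t≤ ⟩
          2 * h + 3        ∎)

  result : _
  result with FinP.any? HasNonAdj?
  ... | no complete = inj₁ λ x y x≢y → Bool.¬-not λ xy → complete (y , x , x≢y , xy)
  ... | yes some =
    let y , hasNon , maxY = argmax HasNonAdj? d some
        x , (x≢y , xy) , maxX = argmax (NonAdj? y) d hasNon
    in inj₂ (x , y , x≢y , xy , large x y x≢y
         (maxY x (y , x≢y ∘ sym , trans (adj-sym G y x) xy)) maxX)

-- Adding an edge

module _ (G : Graph n) (x y : Fin n) (x≢y : x ≢ y) where

  isNew : Fin n → Fin n → Bool
  isNew u v = (⌊ u ≟ x ⌋ ∧ ⌊ v ≟ y ⌋) ∨ (⌊ u ≟ y ⌋ ∧ ⌊ v ≟ x ⌋)

  addEdge : Graph n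
  adj addEdge u v = adj G u v ∨ isNew u v
  adj-sym addEdge u v = cong₂ _∨_ (adj-sym G u v)
    (trans (Bool.∨-comm (⌊ u ≟ x ⌋ ∧ ⌊ v ≟ y ⌋) _)
      (cong₂ _∨_ (Bool.∧-comm ⌊ u ≟ y ⌋ _) (Bool.∧-comm ⌊ u ≟ x ⌋ _)))
  irrefl addEdge v rewrite irrefl G v with v ≟ x | v ≟ y
  ... | yes refl | yes refl = contradiction refl x≢y
  ... | yes _    | no _     = refl
  ... | no _     | yes _    = refl
  ... | no _     | no _     = refl

  addEdge-edge : ∀ {u v} → Adj addEdge u v → Adj G u v ⊎ (u ≡ x × v ≡ y) ⊎ (u ≡ y × v ≡ x)
  addEdge-edge {u} {v} uv with adj G u v | u ≟ x | v ≟ y | u ≟ y | v ≟ x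
  ... | true  | _ | _ | _ | _ = inj₁ _
  ... | false | yes p | yes q | _ | _ = inj₂ (inj₁ (p , q))
  ... | false | yes _ | no _ | yes p | yes q = inj₂ (inj₂ (p , q))
  ... | false | no _ | _ | yes p | yes q = inj₂ (inj₂ (p , q))

  private
    module G = Degrees G
    module G′ = Degrees addEdge

  edge≤ : ∀ i j → G.edge i j ≤ G′.edge i j
  edge≤ i j with adj G i j
  ... | true  = ≤-refl
  ... | false = z≤n

  degree≤ : ∀ i → degree G i ≤ degree addEdge i
  degree≤ i = ℕP.≤-trans (≤-reflexive (G.degree≡sum i))
    (ℕP.≤-trans (sum-mono (edge≤ i)) (≤-reflexive (sym (G′.degree≡sum i))))

  degreeSum< : adj G x y ≡ false → G.degreeSum < G′.degreeSum
  degreeSum< xy = sum-mono-< x degree≤ (ℕP.≤-trans (≤-reflexive (cong suc (G.degree≡sum x)))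
    (ℕP.≤-trans (sum-mono-< y (edge≤ x) new) (≤-reflexive (sym (G′.degree≡sum x)))))
    where
    new : G.edge x y < G′.edge x y
    new rewrite xy with x ≟ x | y ≟ y
    ... | yes _  | yes _  = ≤-refl
    ... | no x≢x | _      = contradiction refl x≢x
    ... | _      | no y≢y = contradiction refl y≢y

  addEdge-fewLow : ∀ {t δ h} → FewLow G t δ h → FewLow addEdge t δ h
  addEdge-fewLow {t} (δ≤deg , few) = (λ v → ≤-trans (δ≤deg v) (degree≤ v)) ,
    λ k δ≤k k≤h → ≤-trans (ℕP.+-monoˡ-≤ t (sum-mono (low k))) (few k δ≤k k≤h)
    where
    low : ∀ k i → ι ⌊ degree addEdge i ≤? k ⌋ ≤ ι ⌊ degree G i ≤? k ⌋
    low k i with degree addEdge i ≤? k | degree G i ≤? k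
    ... | yes _  | yes _  = ≤-refl
    ... | yes d′ | no ¬d  = contradiction (≤-trans (degree≤ i) d′) ¬d
    ... | no _   | _      = z≤n

-- Walks and path covers

∀⊎∃ : {P Q : Fin n → Set} → (∀ i → P i ⊎ Q i) → (∀ i → P i) ⊎ ∃[ i ] Q i
∀⊎∃ {zero}  f = inj₁ λ ()
∀⊎∃ {suc n} f with f zero | ∀⊎∃ (f ∘ suc)
... | inj₂ q | _            = inj₂ (zero , q)
... | inj₁ p | inj₂ (i , q) = inj₂ (suc i , q)
... | inj₁ p | inj₁ ps      = inj₁ λ { zero → p ; (suc i) → ps i }

-- Add to each sum the values of the other function at i and j: the two enlarged sums agree term by
-- term. This stands in for subtracting the two changed terms.
sum-exchange : (s s′ : Fin n → ℕ) (i j : Fin n) → s′ i + s′ j ≡ s i + s j →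
  (∀ k → k ≢ i → k ≢ j → s′ k ≡ s k) → i ≢ j → sum s′ ≡ sum s
sum-exchange s s′ i j eq same i≢j = ℕP.+-cancelʳ-≡ (s i + s j) _ _
  (trans (sym (expand s′ s)) (trans (sum-cong-≗ pointwise) (trans (expand s s′) (cong (sum s +_) eq))))
  where
  expand : ∀ r r′ → sum (λ k → r k + (ι ⌊ k ≟ i ⌋ * r′ k + ι ⌊ k ≟ j ⌋ * r′ k)) ≡ sum r + (r′ i + r′ j)
  expand r r′ = trans (∑-distrib-+ r _) (cong (sum r +_)
    (trans (∑-distrib-+ (λ k → ι ⌊ k ≟ i ⌋ * r′ k) _) (cong₂ _+_ (sum-indicator i r′) (sum-indicator j r′))))
  pointwise : ∀ k → s′ k + (ι ⌊ k ≟ i ⌋ * s k + ι ⌊ k ≟ j ⌋ * s k)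
                  ≡ s k + (ι ⌊ k ≟ i ⌋ * s′ k + ι ⌊ k ≟ j ⌋ * s′ k)
  pointwise k with k ≟ i | k ≟ j
  ... | yes refl | yes refl = contradiction refl i≢j
  ... | yes _ | no _ = solve 2 (λ a b → a :+ (con 1 :* b :+ con 0) := b :+ (con 1 :* a :+ con 0)) refl (s′ k) (s k)
    where open +-*-Solver
  ... | no _ | yes _ = solve 2 (λ a b → a :+ (con 1 :* b) := b :+ (con 1 :* a)) refl (s′ k) (s k)
    where open +-*-Solver
  ... | no k≢i | no k≢j = cong (_+ 0) (same k k≢i k≢j)

-- One weight sum serves for multiplicity (`at w`), length (`size`) and number of neighbours
-- (`ι ∘ adj G p`).
tally : (Fin n → ℕ) → List (Fin n) → ℕ
tally f []      = 0
tally f (v ∷ l) = f v + tally f l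

at : Fin n → Fin n → ℕ
at w v = ι ⌊ v ≟ w ⌋

at-self : (w : Fin n) → at w w ≡ 1
at-self w = ι-yes (w ≟ w) refl

size : List (Fin n) → ℕ
size = tally (λ _ → 1)

tally-++ : ∀ (f : Fin n → ℕ) l m → tally f (l ++ m) ≡ tally f l + tally f m
tally-++ f []      m = refl
tally-++ f (v ∷ l) m = trans (cong (f v +_) (tally-++ f l m)) (sym (ℕP.+-assoc (f v) _ _))

tally-filter : ∀ {k} (f : Fin n → ℕ) (p : Fin n → Bool) (g : Fin k → Fin n) →
  tally f (filterᵇ p (tabulate g)) ≡ sum (λ i → ι (p (g i)) * f (g i))
tally-filter {k = zero}  f p g = refl
tally-filter {k = suc k} f p g with p (g zero)
... | true  = cong₂ _+_ (sym (ℕP.*-identityˡ _)) (tally-filter f p (g ∘ suc))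
... | false = tally-filter f p (g ∘ suc)

∈⇒tally : ∀ {w : Fin n} {l} → w ∈ l → 1 ≤ tally (at w) l
∈⇒tally {w = w} (here refl) = ≤-trans (≤-reflexive (sym (at-self w))) (ℕP.m≤m+n _ _)
∈⇒tally (there w∈l) = ≤-trans (∈⇒tally w∈l) (ℕP.m≤n+m _ _)

tally⇒∈ : ∀ {w : Fin n} l → 1 ≤ tally (at w) l → w ∈ l
tally⇒∈ {w = w} (v ∷ l) 1≤ with v ≟ w
... | yes refl = here refl
... | no _     = there (tally⇒∈ l 1≤)

tally≤1⇒unique : ∀ {l : List (Fin n)} → (∀ w → tally (at w) l ≤ 1) → Unique l
tally≤1⇒unique {l = []}    _ = []
tally≤1⇒unique {l = v ∷ l} h = absent l fresh ∷ tally≤1⇒unique λ w → ≤-trans (ℕP.m≤n+m _ _) (h w)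
  where
  fresh : tally (at v) l ≤ 0
  fresh = ℕP.+-cancelˡ-≤ 1 _ _ (subst (λ z → z + tally (at v) l ≤ 1) (at-self v) (h v))
  absent : ∀ m → tally (at v) m ≤ 0 → All (v ≢_) m
  absent []      _  = []
  absent (w ∷ m) ≤0 = (λ { refl → case ≤-trans (≤-reflexive (sym (at-self v))) (≤-trans (ℕP.m≤m+n _ _) ≤0) of λ () })
                    ∷ absent m (≤-trans (ℕP.m≤n+m _ _) ≤0)

-- The list holds the vertices of the walk after its first one.
data Walk (G : Graph n) : Fin n → List (Fin n) → Fin n → Set where
  []  : ∀ {a} → Walk G a [] a
  _∷_ : ∀ {a b c l} → Adj G a b → Walk G b l c → Walk G a (b ∷ l) c

module _ {G : Graph n} where

  Adj-sym : ∀ {a b} → Adj G a b → Adj G b a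
  Adj-sym {a} {b} = subst T (adj-sym G a b)

  _⋯_ : ∀ {a b c l m} → Walk G a l b → Walk G b m c → Walk G a (l ++ m) c
  []       ⋯ q = q
  (ab ∷ p) ⋯ q = ab ∷ (p ⋯ q)

  -- The list of a walk omits its first vertex, so reversal changes which end is omitted; adding
  -- that end back on each side makes the totals agree.
  walk-reverse : ∀ {a c l} → Walk G a l c →
    ∃[ m ] Walk G c m a × (∀ f → f c + tally f m ≡ f a + tally f l)
  walk-reverse [] = [] , [] , λ _ → refl
  walk-reverse {a} {c} {b ∷ l} (ab ∷ p) with walk-reverse p
  ... | m , q , eq = m ++ [ a ] , q ⋯ (Adj-sym ab ∷ []) , λ f → begin
    f c + tally f (m ++ [ a ])      ≡⟨ cong (f c +_) (tally-++ f m [ a ]) ⟩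
    f c + (tally f m + (f a + 0))   ≡⟨ solve 3 (λ c m a → c :+ (m :+ (a :+ con 0)) := a :+ (c :+ m)) refl (f c) (tally f m) (f a) ⟩
    f a + (f c + tally f m)         ≡⟨ cong (f a +_) (eq f) ⟩
    f a + (f b + tally f l)         ∎
    where open ≡-Reasoning
          open +-*-Solver

  walk-end : ∀ {a c l} → Walk G a l c → 1 ≤ at c a + tally (at c) l
  walk-end {a} []           = ≤-trans (≤-reflexive (sym (at-self a))) (ℕP.m≤m+n _ 0)
  walk-end {a} {c} (_ ∷ p) = ≤-trans (walk-end p) (ℕP.m≤n+m _ (at c a))

  walk-last : ∀ {a c l} → Walk G a l c → last (a ∷ l) ≡ just c
  walk-last []           = refl
  walk-last (_ ∷ [])     = refl
  walk-last (_ ∷ p@(_ ∷ _)) = walk-last p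

  walk-linked : ∀ {a c l} → Walk G a l c → Linked (Adj G) (a ∷ l)
  walk-linked []           = [-]
  walk-linked (ab ∷ [])    = ab ∷ [-]
  walk-linked (ab ∷ p@(_ ∷ _)) = ab ∷ walk-linked p

  -- For f and g the neighbourhoods of the ends of a missing edge this is the Bondy-Chvátal
  -- crossing, the walk being cut between consecutive vertices z and z′. Their own edge is not
  -- recorded, because every rerouting drops it.
  Crossing : (f g : Fin n → Bool) (a : Fin n) (l : List (Fin n)) (c : Fin n) → Set
  Crossing f g a l c = ∃[ z ] ∃[ z′ ] ∃[ l₁ ] ∃[ l₂ ] T (f z) × T (g z′) ×
    Walk G a l₁ z × Walk G z′ l₂ c × (∀ φ → tally φ l₁ + (φ z′ + tally φ l₂) ≡ tally φ l)

  -- Without a crossing, each of the `size l` steps from z to z′ contributes at most 1 to f(z) +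
  -- g(z′). Over all steps this counts f everywhere but at the end c and g everywhere but at the
  -- start a, hence the two corrections.
  crossing : ∀ f g {a l c} → Walk G a l c → Crossing f g a l c ⊎
    tally (ι ∘ f) (a ∷ l) + tally (ι ∘ g) (a ∷ l) ≤ size l + ι (g a) + ι (f c)
  crossing f g {a} [] = inj₂ (≤-reflexive (solve 2 (λ x y → x :+ con 0 :+ (y :+ con 0) := y :+ x) refl (ι (f a)) (ι (g a))))
    where open +-*-Solver
  crossing f g {a} {b ∷ l} {c} (ab ∷ p) with crossing f g p
  ... | inj₁ (z , z′ , l₁ , l₂ , fz , gz′ , p₁ , p₂ , eq) =
    inj₁ (z , z′ , b ∷ l₁ , l₂ , fz , gz′ , ab ∷ p₁ , p₂ ,
          λ φ → trans (ℕP.+-assoc (φ b) _ _) (cong (φ b +_) (eq φ)))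
  ... | inj₂ bound with f a in fa | g b in gb
  ... | true | true = inj₁ (a , b , [] , l , subst T (sym fa) _ , subst T (sym gb) _ , [] , p , λ _ → refl)
  ... | false | gb′ = inj₂ (≤-transfer (ℕP.+-mono-≤ (ι≤1 gb′) bound)
      (≤-reflexive (solve 6 (λ F ga H s gb fc → F :+ (ga :+ H) :+ (con 1 :+ (s :+ gb :+ fc)) := con 1 :+ s :+ ga :+ fc :+ (gb :+ (F :+ H)))
        refl (tally (ι ∘ f) (b ∷ l)) (ι (g a)) (ι gb′ + tally (ι ∘ g) l) (size l) (ι gb′) (ι (f c)))))
    where open +-*-Solver
  ... | true | false = inj₂ (≤-transfer bound
      (≤-reflexive (solve 5 (λ F ga H s fc → con 1 :+ F :+ (ga :+ H) :+ (s :+ con 0 :+ fc) := con 1 :+ s :+ ga :+ fc :+ (F :+ H))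
        refl (tally (ι ∘ f) (b ∷ l)) (ι (g a)) (tally (ι ∘ g) l) (size l) (ι (f c)))))
    where open +-*-Solver

-- Since `exact` holds for every weight, it says that each vertex other than u occurs exactly once
-- in the routes and u never: u starts every path but is counted once, outside them. Weights `at w`,
-- 1 and a neighbourhood yield multiplicities, the order n and degrees.
record Cover (G : Graph n) (u : Fin n) (v : Fin t → Fin n) : Set where
  field
    route : Fin t → List (Fin n)
    walks : ∀ j → Walk G u (route j) (v j)
    exact : ∀ f → f u + sum (λ j → tally f (route j)) ≡ sum f

  once : ∀ w → at w u + sum (λ j → tally (at w) (route j)) ≡ 1
  once w = trans (exact (at w)) (sum-⌊≟⌋ w)

module _ {G : Graph n} {u : Fin n} {v : Fin (suc t) → Fin n} (cover : Cover G u v) where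
  open Cover cover renaming (route to Q)

  cover⇒paths : ∃[ P ] (∀ j → IsPath G u (v j) (P j)) × (∀ w → ∃[ j ] w ∈ P j) ×
    (∀ i j → i ≢ j → ∀ w → w ∈ P i → w ∈ P j → w ≡ u)
  cover⇒paths = (λ j → u ∷ Q j) , path , covers , disjoint
    where
    path : ∀ j → IsPath G u (v j) (u ∷ Q j)
    path j = refl , walk-last (walks j) , walk-linked (walks j) , tally≤1⇒unique λ w →
      ≤-trans (ℕP.+-monoʳ-≤ (at w u) (term≤sum (λ j → tally (at w) (Q j)) j)) (≤-reflexive (once w))
    covers : ∀ w → ∃[ j ] w ∈ u ∷ Q j
    covers w with u ≟ w | once w
    -- The vertex u is on every path, and `suc t` guarantees that there is one.
    ... | yes refl | _ = zero , here refl
    ... | no _     | eq with sum-positive (λ j → tally (at w) (Q j)) (≤-reflexive (sym eq))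
    ... | j , 1≤ = j , there (tally⇒∈ (Q j) 1≤)
    disjoint : ∀ i j → i ≢ j → ∀ w → w ∈ u ∷ Q i → w ∈ u ∷ Q j → w ≡ u
    disjoint i j i≢j w (here w≡u) _ = w≡u
    disjoint i j i≢j w (there _) (here w≡u) = w≡u
    disjoint i j i≢j w (there w∈i) (there w∈j) = contradiction
      (≤-trans (ℕP.+-mono-≤ (∈⇒tally w∈i) (∈⇒tally w∈j))
        (≤-trans (twoTerms≤sum (λ j → tally (at w) (Q j)) i j i≢j)
          (≤-trans (ℕP.m≤n+m _ (at w u)) (≤-reflexive (once w)))))
      λ { (s≤s ()) }

complete-walk : ∀ {G : Graph n} → (∀ x y → x ≢ y → adj G x y ≡ true) → ∀ {a c} l →
  (∀ w → tally (at w) (a ∷ l ++ [ c ]) ≤ 1) → Walk G a (l ++ [ c ]) c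
complete-walk complete {a} {c} [] h = subst T (sym (complete a c a≢c)) _ ∷ []
  where
  a≢c : a ≢ c
  a≢c refl = contradiction (h a) (λ h → case ≤-trans (≤-reflexive (sym (cong₂ _+_ (at-self a) (cong (_+ 0) (at-self a))))) h of λ { (s≤s ()) })
complete-walk complete {a} {c} (b ∷ l) h = subst T (sym (complete a b a≢b)) _
    ∷ complete-walk complete l (λ w → ≤-trans (ℕP.m≤n+m _ (at w a)) (h w))
  where
  a≢b : a ≢ b
  a≢b refl = contradiction (h a) (λ h → case ≤-trans (≤-reflexive (sym (cong₂ (λ p q → p + (q + tally (at a) (l ++ [ c ]))) (at-self a) (at-self a)))) h of λ { (s≤s ()) })

-- The path to `v zero` absorbs all vertices that are neither u nor a terminal; every other path is
-- a single edge.
complete-cover : ∀ {G : Graph n} → (∀ x y → x ≢ y → adj G x y ≡ true) →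
  ∀ u (v : Fin (suc t) → Fin n) → Injective _≡_ _≡_ v → (∀ i → v i ≢ u) → Cover G u v
complete-cover {n} {t} {G} complete u v v-inj v≢u = record { route = Q ; walks = walks ; exact = exact }
  where
  terminal? : ∀ w → Dec (∃[ j ] v j ≡ w)
  terminal? w = FinP.any? λ j → v j ≟ w
  free : Fin n → Bool
  free w = not (⌊ w ≟ u ⌋ ∨ ⌊ terminal? w ⌋)
  rest : List (Fin n)
  rest = filterᵇ free (tabulate λ i → i)
  Q : Fin (suc t) → List (Fin n)
  Q zero    = rest ++ [ v zero ]
  Q (suc j) = [ v (suc j) ]
  partition : ∀ w → at u w + (ι (free w) + sum (λ j → at (v j) w)) ≡ 1
  partition w with w ≟ u | terminal? w
  ... | yes refl | _ = cong suc (sum-zero λ j → ι-no (w ≟ v j) (v≢u j ∘ sym))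
  ... | no _ | yes (j , refl) = trans (sum-single j λ i i≢j → ι-no (v j ≟ v i) (i≢j ∘ sym ∘ v-inj)) (at-self (v j))
  ... | no _ | no none = cong suc (sum-zero λ j → ι-no (w ≟ v j) λ w≡ → none (j , sym w≡))
  exact : ∀ f → f u + sum (λ j → tally f (Q j)) ≡ sum f
  exact f = begin
    f u + (tally f (rest ++ [ v zero ]) + sum (λ j → f (v (suc j)) + 0))
      ≡⟨ cong₂ (λ p q → f u + (p + q)) (tally-++ f rest _) (sum-cong-≗ λ j → ℕP.+-identityʳ (f (v (suc j)))) ⟩
    f u + (tally f rest + (f (v zero) + 0) + sum (λ j → f (v (suc j))))
      ≡⟨ cong (f u +_) (trans (cong (λ z → tally f rest + z + sum (λ j → f (v (suc j)))) (ℕP.+-identityʳ (f (v zero)))) (ℕP.+-assoc (tally f rest) _ _)) ⟩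
    f u + (tally f rest + sum (λ j → f (v j)))
      ≡⟨ cong₂ (λ p q → p + (tally f rest + q)) (sum-indicator u f) (sum-cong-≗ λ j → sum-indicator (v j) f) ⟨
    sum (λ w → at u w * f w) + (tally f rest + sum (λ j → sum λ w → at (v j) w * f w))
      ≡⟨ cong₂ (λ p q → sum (λ w → at u w * f w) + (p + q)) (tally-filter f free (λ i → i)) (∑-comm (λ j w → at (v j) w * f w)) ⟩
    sum (λ w → at u w * f w) + (sum (λ w → ι (free w) * f w) + sum (λ w → sum λ j → at (v j) w * f w))
      ≡⟨ trans (∑-distrib-+ (λ w → at u w * f w) _) (cong (sum (λ w → at u w * f w) +_) (∑-distrib-+ (λ w → ι (free w) * f w) _)) ⟨
    sum (λ w → at u w * f w + (ι (free w) * f w + sum λ j → at (v j) w * f w))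
      ≡⟨ sum-cong-≗ pointwise ⟩
    sum f ∎
    where
    open ≡-Reasoning
    pointwise : ∀ w → at u w * f w + (ι (free w) * f w + sum (λ j → at (v j) w * f w)) ≡ f w
    pointwise w = begin
      at u w * f w + (ι (free w) * f w + sum (λ j → at (v j) w * f w))
        ≡⟨ cong (λ z → at u w * f w + (ι (free w) * f w + z)) (*-distribʳ-sum (f w) (λ j → at (v j) w)) ⟨
      at u w * f w + (ι (free w) * f w + sum (λ j → at (v j) w) * f w)
        ≡⟨ solve 4 (λ a b c d → a :* d :+ (b :* d :+ c :* d) := (a :+ (b :+ c)) :* d) refl (at u w) (ι (free w)) (sum λ j → at (v j) w) (f w) ⟩
      (at u w + (ι (free w) + sum (λ j → at (v j) w))) * f w
        ≡⟨ cong (_* f w) (partition w) ⟩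
      1 * f w ≡⟨ ℕP.*-identityˡ (f w) ⟩
      f w ∎
      where open +-*-Solver
  walks : ∀ j → Walk G u (Q j) (v j)
  walks zero    = complete-walk complete rest λ w →
    ≤-trans (ℕP.+-monoʳ-≤ (at w u) (term≤sum (λ j → tally (at w) (Q j)) zero)) (≤-reflexive (trans (exact (at w)) (sum-⌊≟⌋ w)))
  walks (suc j) = subst T (sym (complete u (v (suc j)) (v≢u (suc j) ∘ sym))) _ ∷ []

-- Rerouting path covers

at-absent : ∀ {w v : Fin n} → at w v ≡ 0 → v ≢ w
at-absent {w = w} eq refl with () ← trans (sym eq) (at-self w)

at-other : ∀ {w v : Fin n} → v ≢ w → at w v ≡ 0
at-other {w = w} {v} = ι-no (v ≟ w)

-- A cover of G but for one missing edge pq: path i is broken into a walk ending at p and a walk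
-- starting at q.
record SplitCover (G : Graph n) (u : Fin n) (v : Fin t → Fin n) (p q : Fin n) : Set where
  field
    route  : Fin t → List (Fin n)
    i      : Fin t
    l₁ l₂  : List (Fin n)
    walk₁  : Walk G u l₁ p
    walk₂  : Walk G q l₂ (v i)
    walks  : ∀ j → j ≢ i → Walk G u (route j) (v j)
    splits : ∀ f → tally f l₁ + (f q + tally f l₂) ≡ tally f (route i)
    exact  : ∀ f → f u + sum (λ j → tally f (route j)) ≡ sum f

module _ {G : Graph n} {x y : Fin n} (x≢y : x ≢ y) where

  private
    G′ = addEdge G x y x≢y

  NewEdge : Fin n → Fin n → Set
  NewEdge p q = (p ≡ x × q ≡ y) ⊎ (p ≡ y × q ≡ x)

  FirstUse : (a : Fin n) (l : List (Fin n)) (c : Fin n) → Set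
  FirstUse a l c = ∃[ p ] ∃[ q ] ∃[ l₁ ] ∃[ l₂ ] NewEdge p q × Walk G a l₁ p ×
    Walk G′ q l₂ c × (∀ f → tally f l₁ + (f q + tally f l₂) ≡ tally f l)

  firstUse : ∀ {a l c} → Walk G′ a l c → Walk G a l c ⊎ FirstUse a l c
  firstUse [] = inj₁ []
  firstUse {a} {b ∷ l} (ab ∷ w) with addEdge-edge G x y x≢y ab | firstUse w
  ... | inj₂ new | _ = inj₂ (a , b , [] , l , new , [] , w , λ _ → refl)
  ... | inj₁ old | inj₁ w′ = inj₁ (old ∷ w′)
  ... | inj₁ old | inj₂ (p , q , l₁ , l₂ , new , w₁ , w₂ , eq) =
    inj₂ (p , q , b ∷ l₁ , l₂ , new , old ∷ w₁ , w₂ , λ f → trans (ℕP.+-assoc (f b) _ _) (cong (f b +_) (eq f)))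

  -- Each use of the new edge visits both of its ends, so missing one of them is enough.
  avoiding : ∀ {z} → z ≡ x ⊎ z ≡ y → ∀ {a l c} → Walk G′ a l c →
             at z a + tally (at z) l ≡ 0 → Walk G a l c
  avoiding _ [] _ = []
  avoiding {z} z∈ {a} {b ∷ l} (ab ∷ w) none with addEdge-edge G x y x≢y ab
  ... | inj₁ old = old ∷ avoiding z∈ w (ℕP.m+n≡0⇒n≡0 (at z a) none)
  ... | inj₂ new = ⊥-elim (absurd z∈ new)
    where
    a≢z : a ≢ z
    a≢z = at-absent (ℕP.m+n≡0⇒m≡0 (at z a) none)
    b≢z : b ≢ z
    b≢z = at-absent (ℕP.m+n≡0⇒m≡0 (at z b) (ℕP.m+n≡0⇒n≡0 (at z a) none))
    absurd : z ≡ x ⊎ z ≡ y → NewEdge a b → ⊥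
    absurd (inj₁ refl) (inj₁ (a≡ , _)) = a≢z a≡
    absurd (inj₁ refl) (inj₂ (_ , b≡)) = b≢z b≡
    absurd (inj₂ refl) (inj₁ (_ , b≡)) = b≢z b≡
    absurd (inj₂ refl) (inj₂ (a≡ , _)) = a≢z a≡

  -- By exactness a cover uses the new edge at most once in all, so cutting one path at its first
  -- use leaves only edges of G.
  split-cover : ∀ {u} {v : Fin t → Fin n} → Cover G′ u v →
    Cover G u v ⊎ ∃[ p ] ∃[ q ] NewEdge p q × SplitCover G u v p q
  split-cover {t} {u} {v} cover with ∀⊎∃ (λ j → firstUse (Cover.walks cover j))
  ... | inj₁ old = inj₁ (record { route = Cover.route cover ; walks = old ; exact = Cover.exact cover })
  ... | inj₂ (i , p , q , l₁ , l₂ , new , w₁ , w₂ , eq) = inj₂ (p , q , new , record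
    { route = Q ; i = i ; l₁ = l₁ ; l₂ = l₂ ; walk₁ = w₁
    ; walk₂ = avoiding p∈ w₂ rest≡0
    ; walks = others
    ; splits = eq ; exact = exact })
    where
    open Cover cover renaming (route to Q)
    p∈ : p ≡ x ⊎ p ≡ y
    p∈ = case new of λ { (inj₁ (e , _)) → inj₁ e ; (inj₂ (e , _)) → inj₂ e }
    q∈ : q ≡ x ⊎ q ≡ y
    q∈ = case new of λ { (inj₁ (_ , e)) → inj₂ e ; (inj₂ (_ , e)) → inj₁ e }
    p≢q : p ≢ q
    p≢q = case new of λ { (inj₁ (refl , refl)) → x≢y ; (inj₂ (refl , refl)) → x≢y ∘ sym }
    occ = λ w j → tally (at w) (Q j)
    rest≡0 : at p q + tally (at p) l₂ ≡ 0
    rest≡0 = ℕP.n≤0⇒n≡0 (ℕP.+-cancelˡ-≤ 1 _ _ (begin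
      1 + (at p q + tally (at p) l₂)                        ≤⟨ ℕP.+-monoˡ-≤ _ (walk-end w₁) ⟩
      at p u + tally (at p) l₁ + (at p q + tally (at p) l₂) ≡⟨ ℕP.+-assoc (at p u) _ _ ⟩
      at p u + (tally (at p) l₁ + (at p q + tally (at p) l₂)) ≡⟨ cong (at p u +_) (eq (at p)) ⟩
      at p u + occ p i                                        ≤⟨ ℕP.+-monoʳ-≤ (at p u) (term≤sum (occ p) i) ⟩
      at p u + sum (occ p)                                    ≡⟨ once p ⟩
      1                                                     ∎))
      where open ℕP.≤-Reasoning
    elsewhere : ∀ {z j} → j ≢ i → u ≢ z → 1 ≤ occ z i → at z u + occ z j ≡ 0
    elsewhere {z} {j} j≢i u≢z 1≤ = ℕP.n≤0⇒n≡0 (ℕP.+-cancelˡ-≤ 1 _ _ (begin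
      1 + (at z u + occ z j)       ≤⟨ ℕP.+-monoˡ-≤ _ 1≤ ⟩
      occ z i + (at z u + occ z j)   ≡⟨ solve 3 (λ a b c → a :+ (b :+ c) := b :+ (c :+ a)) refl (occ z i) (at z u) (occ z j) ⟩
      at z u + (occ z j + occ z i)   ≤⟨ ℕP.+-monoʳ-≤ (at z u) (twoTerms≤sum (occ z) j i j≢i) ⟩
      at z u + sum (occ z)         ≡⟨ once z ⟩
      1                          ∎))
      where open ℕP.≤-Reasoning
            open +-*-Solver
    -- An end of the new edge other than u occurs on path i only. If p = u, it is common to all
    -- paths, and q has to be used instead.
    others : ∀ j → j ≢ i → Walk G u (Q j) (v j)
    others j j≢i with u ≟ p
    ... | no u≢p = avoiding p∈ (walks j) (elsewhere j≢i u≢p (≤-trans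
          (subst (λ z → 1 ≤ z + tally (at p) l₁) (at-other u≢p) (walk-end w₁))
          (≤-trans (ℕP.m≤m+n _ _) (≤-reflexive (eq (at p))))))
    ... | yes refl = avoiding q∈ (walks j) (elsewhere j≢i p≢q (≤-trans
          (≤-trans (≤-reflexive (sym (at-self q))) (ℕP.m≤m+n _ _))
          (≤-trans (ℕP.m≤n+m _ (tally (at q) l₁)) (≤-reflexive (eq (at q))))))

module _ {G : Graph n} {u : Fin n} {v : Fin t → Fin n} {p q : Fin n}
         (split : SplitCover G u v p q) where

  open SplitCover split renaming (route to Q)
  open Degrees G using (degree≡sum)

  private
    f g : Fin n → Bool
    f = adj G p
    g = adj G q

  replace : List (Fin n) → Fin t → List (Fin n)
  replace l k = if ⌊ k ≟ i ⌋ then l else Q k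

  replace-cover : ∀ {l} → Walk G u l (v i) → (∀ φ → tally φ l ≡ tally φ (Q i)) → Cover G u v
  replace-cover {l} w eq = record { route = replace l ; walks = walks′
    ; exact = λ φ → trans (cong (φ u +_) (sum-cong-≗ (same φ))) (exact φ) }
    where
    walks′ : ∀ k → Walk G u (replace l k) (v k)
    walks′ k with k ≟ i
    ... | yes refl = w
    ... | no k≢i   = walks k k≢i
    same : ∀ φ k → tally φ (replace l k) ≡ tally φ (Q k)
    same φ k with k ≟ i
    ... | yes refl = eq φ
    ... | no _     = refl

  exchange-cover : ∀ {j l m} → j ≢ i → Walk G u l (v i) → Walk G u m (v j) →
    (∀ φ → tally φ l + tally φ m ≡ tally φ (Q i) + tally φ (Q j)) → Cover G u v
  exchange-cover {j} {l} {m} j≢i w w′ eq = record { route = Q′ ; walks = walks′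
    ; exact = λ φ → trans (cong (φ u +_) (sum-exchange (tally φ ∘ Q) (tally φ ∘ Q′) i j
        (trans (cong₂ (λ a b → tally φ a + tally φ b) Q′i Q′j) (eq φ))
        (λ k k≢i k≢j → cong (tally φ) (Q′k k k≢i k≢j)) (j≢i ∘ sym))) (exact φ) }
    where
    Q′ : Fin t → List (Fin n)
    Q′ k = if ⌊ k ≟ j ⌋ then m else replace l k
    Q′i : Q′ i ≡ l
    Q′i with i ≟ j | i ≟ i
    ... | yes i≡j | _      = contradiction (sym i≡j) j≢i
    ... | no _    | yes _  = refl
    ... | no _    | no i≢i = contradiction refl i≢i
    Q′j : Q′ j ≡ m
    Q′j with j ≟ j
    ... | yes _  = refl
    ... | no j≢j = contradiction refl j≢j
    Q′k : ∀ k → k ≢ i → k ≢ j → Q′ k ≡ Q k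
    Q′k k k≢i k≢j with k ≟ j | k ≟ i
    ... | yes k≡j | _       = contradiction k≡j k≢j
    ... | no _    | yes k≡i = contradiction k≡i k≢i
    ... | no _    | no _    = refl
    walks′ : ∀ k → Walk G u (Q′ k) (v k)
    walks′ k with k ≟ j | k ≟ i
    ... | yes refl | _        = w′
    ... | no _     | yes refl = w
    ... | no _     | no k≢i   = walks k k≢i

  -- The new path i runs from u to z, jumps to p, goes back along the old walk to z′, and jumps to q
  -- and on to `v i`.
  cross₁ : Crossing f g u l₁ p → Cover G u v
  cross₁ (z , z′ , m₁ , m₂ , pz , qz′ , w₁ , w₂ , eq) with walk-reverse w₂
  ... | r , w₃ , eqr = replace-cover
      (w₁ ⋯ (Adj-sym {G = G} pz ∷ (w₃ ⋯ (Adj-sym {G = G} qz′ ∷ walk₂)))) λ φ → begin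
    tally φ (m₁ ++ p ∷ r ++ q ∷ l₂)
      ≡⟨ trans (tally-++ φ m₁ _) (cong (λ s → tally φ m₁ + (φ p + s)) (tally-++ φ r _)) ⟩
    tally φ m₁ + (φ p + (tally φ r + (φ q + tally φ l₂)))
      ≡⟨ cong (tally φ m₁ +_) (trans (sym (ℕP.+-assoc (φ p) _ _)) (cong (_+ (φ q + tally φ l₂)) (eqr φ))) ⟩
    tally φ m₁ + (φ z′ + tally φ m₂ + (φ q + tally φ l₂))
      ≡⟨ trans (sym (ℕP.+-assoc (tally φ m₁) _ _)) (cong (_+ (φ q + tally φ l₂)) (eq φ)) ⟩
    tally φ l₁ + (φ q + tally φ l₂)
      ≡⟨ splits φ ⟩
    tally φ (Q i) ∎
    where open ≡-Reasoning

  -- The new path i runs from u to p, jumps to z, goes back along the old walk to q, and jumps to z′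
  -- and on to `v i`.
  cross₂ : Crossing f g q l₂ (v i) → Cover G u v
  cross₂ (z , z′ , m₁ , m₂ , pz , qz′ , w₁ , w₂ , eq) with walk-reverse w₁
  ... | r , w₃ , eqr = replace-cover (walk₁ ⋯ (pz ∷ (w₃ ⋯ (qz′ ∷ w₂)))) λ φ → begin
    tally φ (l₁ ++ z ∷ r ++ z′ ∷ m₂)
      ≡⟨ trans (tally-++ φ l₁ _) (cong (λ s → tally φ l₁ + (φ z + s)) (tally-++ φ r _)) ⟩
    tally φ l₁ + (φ z + (tally φ r + (φ z′ + tally φ m₂)))
      ≡⟨ cong (tally φ l₁ +_) (trans (sym (ℕP.+-assoc (φ z) _ _)) (cong (_+ (φ z′ + tally φ m₂)) (eqr φ))) ⟩
    tally φ l₁ + (φ q + tally φ m₁ + (φ z′ + tally φ m₂))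
      ≡⟨ cong (tally φ l₁ +_) (trans (ℕP.+-assoc (φ q) _ _) (cong (φ q +_) (eq φ))) ⟩
    tally φ l₁ + (φ q + tally φ l₂)
      ≡⟨ splits φ ⟩
    tally φ (Q i) ∎
    where open ≡-Reasoning

  -- Paths i and j exchange tails: u to z, then q and on to `v i`; u to p, then z′ and on to `v j`.
  -- The order of `g` and `f` is reversed because the first part of path j now leads into q.
  cross₃ : ∀ {j} → j ≢ i → Crossing g f u (Q j) (v j) → Cover G u v
  cross₃ {j} j≢i (z , z′ , m₁ , m₂ , qz , pz′ , w₁ , w₂ , eq) = exchange-cover j≢i
    (w₁ ⋯ (Adj-sym {G = G} qz ∷ walk₂)) (walk₁ ⋯ (pz′ ∷ w₂)) λ φ → begin
    tally φ (m₁ ++ q ∷ l₂) + tally φ (l₁ ++ z′ ∷ m₂)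
      ≡⟨ cong₂ _+_ (tally-++ φ m₁ _) (tally-++ φ l₁ _) ⟩
    tally φ m₁ + (φ q + tally φ l₂) + (tally φ l₁ + (φ z′ + tally φ m₂))
      ≡⟨ solve 4 (λ m a l b → m :+ a :+ (l :+ b) := l :+ a :+ (m :+ b)) refl
           (tally φ m₁) (φ q + tally φ l₂) (tally φ l₁) (φ z′ + tally φ m₂) ⟩
    tally φ l₁ + (φ q + tally φ l₂) + (tally φ m₁ + (φ z′ + tally φ m₂))
      ≡⟨ cong₂ _+_ (splits φ) (eq φ) ⟩
    tally φ (Q i) + tally φ (Q j) ∎
    where open ≡-Reasoning
          open +-*-Solver

  private
    F H K S : Fin t → ℕ
    F k = tally (ι ∘ f) (Q k)
    H k = tally (ι ∘ g) (Q k)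
    K k = F k + H k
    S k = size (Q k)
    fu gu : ℕ
    fu = ι (f u)
    gu = ι (g u)

  -- The two estimates are for the two parts of path i. Irreflexivity removes the corrections at p
  -- and q, `gu` cancels, and the 1 that bounds `f (v i)` is absorbed by q, which the whole route
  -- counts in addition to `l₁` and `l₂`.
  no-crossing-own :
    tally (ι ∘ f) (u ∷ l₁) + tally (ι ∘ g) (u ∷ l₁) ≤ size l₁ + gu + ι (f p) →
    tally (ι ∘ f) (q ∷ l₂) + tally (ι ∘ g) (q ∷ l₂) ≤ size l₂ + ι (g q) + ι (f (v i)) →
    fu + K i ≤ S i
  no-crossing-own h₁ h₂ rewrite sym (splits (ι ∘ f)) | sym (splits (ι ∘ g))
    | sym (splits (λ _ → 1)) | irrefl G p | irrefl G q =
    ≤-transfer (ℕP.+-mono-≤ h₁ (≤-trans h₂ (ℕP.+-monoʳ-≤ (size l₂ + 0) (ι≤1 (f (v i))))))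
      (≤-reflexive (solve 9 (λ fu gu F₁ H₁ fq F₂ H₂ s₁ s₂ →
          fu :+ (F₁ :+ (fq :+ F₂) :+ (H₁ :+ (con 0 :+ H₂))) :+ (s₁ :+ gu :+ con 0 :+ (s₂ :+ con 0 :+ con 1))
          := s₁ :+ (con 1 :+ s₂) :+ (fu :+ F₁ :+ (gu :+ H₁) :+ (fq :+ F₂ :+ (con 0 :+ H₂))))
        refl fu gu (tally (ι ∘ f) l₁) (tally (ι ∘ g) l₁) (ι (f q)) (tally (ι ∘ f) l₂) (tally (ι ∘ g) l₂) (size l₁) (size l₂)))
    where open +-*-Solver

  no-crossing-other : ∀ j →
    tally (ι ∘ g) (u ∷ Q j) + tally (ι ∘ f) (u ∷ Q j) ≤ size (Q j) + fu + ι (g (v j)) →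
    K j + gu ≤ S j + 1
  no-crossing-other j h = ≤-transfer (≤-trans h (ℕP.+-monoʳ-≤ (size (Q j) + fu) (ι≤1 (g (v j)))))
      (≤-reflexive (solve 5 (λ fu gu F H s → F :+ H :+ gu :+ (s :+ fu :+ con 1) := s :+ con 1 :+ (gu :+ H :+ (fu :+ F)))
        refl fu gu (F j) (H j) (S j)))
    where open +-*-Solver

  -- Summation gives d(p) + d(q) + (t - 2) g(u) ≤ n + t - 2: each of the t - 1 paths other than i
  -- supplies the term g(u) once, while the degree of q consumes it once. So t ≥ 2 allows the
  -- remainder to be dropped.
  no-crossing-sum : 2 ≤ t → fu + K i ≤ S i → (∀ j → j ≢ i → K j + gu ≤ S j + 1) →
    suc (suc (degree G p + degree G q)) ≤ n + t
  no-crossing-sum 2≤t own other = ≤-transfer (ℕP.+-mono-≤ summed (ℕP.*-monoˡ-≤ gu 2≤t)) (begin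
    suc (suc (degree G p + degree G q)) + (sum S + t + gu + t * gu)
      ≡⟨ cong (λ z → suc (suc z) + (sum S + t + gu + t * gu)) (cong₂ _+_ (deg p) (deg q)) ⟩
    suc (suc (fu + sum F + (gu + sum H))) + (sum S + t + gu + t * gu)
      ≡⟨ solve 7 (λ fu F gu H S t tg →
           con 2 :+ (fu :+ F :+ (gu :+ H)) :+ (S :+ t :+ gu :+ tg)
           := con 1 :+ S :+ t :+ (F :+ H :+ tg :+ (fu :+ con 1) :+ con 2 :* gu)) refl fu (sum F) gu (sum H) (sum S) t (t * gu) ⟩
    1 + sum S + t + (sum F + sum H + t * gu + (fu + 1) + 2 * gu)
      ≡⟨ cong₂ (λ a b → a + t + (b + t * gu + (fu + 1) + 2 * gu)) total (sym (∑-distrib-+ F H)) ⟩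
    n + t + (sum K + t * gu + (fu + 1) + 2 * gu) ∎)
    where
    open ℕP.≤-Reasoning
    open +-*-Solver
    deg : ∀ w → degree G w ≡ ι (adj G w u) + sum (λ k → tally (ι ∘ adj G w) (Q k))
    deg w = trans (degree≡sum w) (sym (exact (ι ∘ adj G w)))
    total : 1 + sum S ≡ n
    total = trans (exact (λ _ → 1)) (trans (sum-const n 1) (ℕP.*-identityʳ n))
    -- The estimate for path i has a different shape; the terms with `at i k` adjust it so that a
    -- single inequality can be summed over all k.
    pointwise : ∀ k → K k + gu + at i k * (fu + 1) ≤ S k + 1 + at i k * gu
    pointwise k with k ≟ i
    ... | yes refl = ≤-transfer own (≤-reflexive (solve 4 (λ c gu fu s →
          c :+ gu :+ con 1 :* (fu :+ con 1) :+ s := s :+ con 1 :+ con 1 :* gu :+ (fu :+ c)) refl (K k) gu fu (S k)))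
    ... | no k≢i = ℕP.+-monoˡ-≤ 0 (other k k≢i)
    summed : sum K + t * gu + (fu + 1) ≤ sum S + t + gu
    summed = begin
      sum K + t * gu + (fu + 1)
        ≡⟨ cong₂ (λ a b → sum K + a + b) (sum-const t gu) (sum-indicator i (λ _ → fu + 1)) ⟨
      sum K + sum {t} (λ _ → gu) + sum (λ k → at i k * (fu + 1))
        ≡⟨ trans (∑-distrib-+ (λ k → K k + gu) _) (cong (_+ sum (λ k → at i k * (fu + 1))) (∑-distrib-+ K _)) ⟨
      sum (λ k → K k + gu + at i k * (fu + 1)) ≤⟨ sum-mono pointwise ⟩
      sum (λ k → S k + 1 + at i k * gu)
        ≡⟨ trans (∑-distrib-+ (λ k → S k + 1) _) (cong (_+ sum (λ k → at i k * gu)) (∑-distrib-+ S _)) ⟩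
      sum S + sum {t} (λ _ → 1) + sum (λ k → at i k * gu)
        ≡⟨ cong₂ (λ a b → sum S + a + b) (trans (sum-const t 1) (ℕP.*-identityʳ t)) (sum-indicator i (λ _ → gu)) ⟩
      sum S + t + gu ∎

  join-cover : 2 ≤ t → n + t ≤ suc (degree G p + degree G q) → Cover G u v
  join-cover 2≤t large with crossing f g walk₁ | crossing f g walk₂ | ∀⊎∃ others
    where
    others : ∀ j → (j ≢ i → K j + gu ≤ S j + 1) ⊎ (j ≢ i × Crossing g f u (Q j) (v j))
    others j with j ≟ i
    ... | yes j≡i = inj₁ λ j≢i → contradiction j≡i j≢i
    ... | no j≢i with crossing g f (walks j j≢i)
    ... | inj₁ c = inj₂ (j≢i , c)
    ... | inj₂ h = inj₁ λ _ → no-crossing-other j h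
  ... | inj₁ c | _ | _ = cross₁ c
  ... | _ | inj₁ c | _ = cross₂ c
  ... | _ | _ | inj₂ (j , j≢i , c) = cross₃ j≢i c
  ... | inj₂ h₁ | inj₂ h₂ | inj₁ hs =
    contradiction large (ℕP.<⇒≱ (no-crossing-sum 2≤t (no-crossing-own h₁ h₂) hs))

-- Descent from the complete graph

removeEdge-cover : ∀ {G : Graph n} {x y u} {v : Fin t → Fin n} (x≢y : x ≢ y) → 2 ≤ t →
  n + t ≤ suc (degree G x + degree G y) → Cover (addEdge G x y x≢y) u v → Cover G u v
removeEdge-cover {n} {t} {G} {x} {y} x≢y 2≤t large cover with split-cover x≢y cover
... | inj₁ done = done
... | inj₂ (p , q , inj₁ (refl , refl) , split) = join-cover split 2≤t large
... | inj₂ (p , q , inj₂ (refl , refl) , split) = join-cover split 2≤t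
  (subst (λ z → n + t ≤ suc z) (ℕP.+-comm (degree G x) (degree G y)) large)

-- The number `fuel` bounds n² minus the degree sum, which each added edge increases; as no degree
-- sum exceeds n², an edge cannot be added once it is zero.
fewLow-cover : ∀ {δ h} → 2 ≤ suc t → n + suc t ≤ 2 * h + 3 → ∀ fuel (G : Graph n) → FewLow G (suc t) δ h →
  n * n ≤ Degrees.degreeSum G + fuel →
  ∀ u (v : Fin (suc t) → Fin n) → Injective _≡_ _≡_ v → (∀ i → v i ≢ u) → Cover G u v
fewLow-cover {t} {n} 2≤t n+t≤ fuel G few enough u v v-inj v≢u with ore-pair G n+t≤ few
... | inj₁ complete = complete-cover complete u v v-inj v≢u
... | inj₂ (x , y , x≢y , xy , large) = removeEdge-cover x≢y 2≤t large (recurse fuel enough)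
  where
  G′ = addEdge G x y x≢y
  more = degreeSum< G x y x≢y xy
  recurse : ∀ fuel → n * n ≤ Degrees.degreeSum G + fuel → Cover G′ u v
  recurse zero enough = contradiction
    (≤-trans (≤-trans more (Degrees.degreeSum≤ G′)) (≤-trans enough (≤-reflexive (ℕP.+-identityʳ _))))
    (ℕP.<-irrefl refl)
  recurse (suc fuel) enough = fewLow-cover 2≤t n+t≤ fuel G′ (addEdge-fewLow G x y x≢y few)
    (≤-trans enough (≤-trans (≤-reflexive (ℕP.+-suc _ fuel)) (ℕP.+-monoˡ-≤ fuel more))) u v v-inj v≢u

dense⇒coverable : ∀ (G : Graph n) {t δ} → 2 ≤ t → t ≤ δ → HasMinDegree G δ →
  2 * h₁ n t δ < Degrees.degreeSum G → OneToManyDisjointPathCoverable G t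
dense⇒coverable {n} G {t@(suc _)} 2≤t t≤δ minDeg dense u v v-inj v≢u = cover⇒paths
  (fewLow-cover 2≤t (≤2*maxδ+3 n t 2≤t) (n * n) G (dense⇒fewLow G 2≤t t≤δ minDeg dense)
    (ℕP.m≤n+m (n * n) (Degrees.degreeSum G)) u v v-inj v≢u)

-- Asymptotically nonnegative reals

-- Abstract, so that conversion checking never unfolds the gcd in the normalised fraction.
abstract
  toℚ : ℕ → ℚ
  toℚ m = (ℤ.+ m) ℚ./ 1

  toℚ-def : ∀ m → toℚ m ≡ (ℤ.+ m) ℚ./ 1
  toℚ-def m = refl

  toℚᵘ-toℚ : ∀ m → ℚ.toℚᵘ (toℚ m) ℚᵘ.≃ ℚᵘ.mkℚᵘ (ℤ.+ m) 0
  toℚᵘ-toℚ m = ℚP.toℚᵘ-fromℚᵘ (ℚᵘ.mkℚᵘ (ℤ.+ m) 0)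

  toℚ-+ : ∀ m k → toℚ (m ℕ.+ k) ≡ toℚ m ℚ.+ toℚ k
  toℚ-+ m k = ℚP.toℚᵘ-injective (begin
    ℚ.toℚᵘ (toℚ (m ℕ.+ k))                ≈⟨ toℚᵘ-toℚ (m ℕ.+ k) ⟩
    ℚᵘ.mkℚᵘ (ℤ.+ (m ℕ.+ k)) 0           ≡⟨ cong (λ z → ℚᵘ.mkℚᵘ z 0) (cong₂ ℤ._+_ (sym (ℤP.*-identityʳ (ℤ.+ m))) (sym (ℤP.*-identityʳ (ℤ.+ k)))) ⟩
    ℚᵘ.mkℚᵘ (ℤ.+ m) 0 ℚᵘ.+ ℚᵘ.mkℚᵘ (ℤ.+ k) 0 ≈⟨ ℚᵘP.+-cong (toℚᵘ-toℚ m) (toℚᵘ-toℚ k) ⟨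
    ℚ.toℚᵘ (toℚ m) ℚᵘ.+ ℚ.toℚᵘ (toℚ k)      ≈⟨ ℚP.toℚᵘ-homo-+ (toℚ m) (toℚ k) ⟨
    ℚ.toℚᵘ (toℚ m ℚ.+ toℚ k)                ∎)
    where open ℚᵘP.≃-Reasoning

  toℚ-* : ∀ m k → toℚ (m ℕ.* k) ≡ toℚ m ℚ.* toℚ k
  toℚ-* m k = ℚP.toℚᵘ-injective (begin
    ℚ.toℚᵘ (toℚ (m ℕ.* k))                ≈⟨ toℚᵘ-toℚ (m ℕ.* k) ⟩
    ℚᵘ.mkℚᵘ (ℤ.+ (m ℕ.* k)) 0           ≡⟨ cong (λ z → ℚᵘ.mkℚᵘ z 0) (ℤP.pos-* m k) ⟩
    ℚᵘ.mkℚᵘ (ℤ.+ m) 0 ℚᵘ.* ℚᵘ.mkℚᵘ (ℤ.+ k) 0 ≈⟨ ℚᵘP.*-cong (toℚᵘ-toℚ m) (toℚᵘ-toℚ k) ⟨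
    ℚ.toℚᵘ (toℚ m) ℚᵘ.* ℚ.toℚᵘ (toℚ k)      ≈⟨ ℚP.toℚᵘ-homo-* (toℚ m) (toℚ k) ⟨
    ℚ.toℚᵘ (toℚ m ℚ.* toℚ k)                ∎)
    where open ℚᵘP.≃-Reasoning

  0≤toℚ : ∀ m → 0ℚ ℚ.≤ toℚ m
  0≤toℚ m = ℚP.nonNegative⁻¹ (toℚ m) {{ℚP.normalize-nonNeg m 1}}

toℚ-sum : (f : Fin n → ℕ) → toℚ (sum f) ≡ sumℚ (toℚ ∘ f)
toℚ-sum {zero}  f = toℚ-def 0
toℚ-sum {suc n} f = trans (toℚ-+ (f zero) _) (cong (toℚ (f zero) ℚ.+_) (toℚ-sum (f ∘ suc)))

0≤* : ∀ {x y} → 0ℚ ℚ.≤ x → 0ℚ ℚ.≤ y → 0ℚ ℚ.≤ x ℚ.* y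
0≤* {x} {y} 0≤x 0≤y = subst (ℚ._≤ x ℚ.* y) (ℚP.*-zeroʳ x) (ℚP.*-monoˡ-≤-nonNeg x {{ℚ.nonNegative 0≤x}} 0≤y)

0≤-⇒≤ : ∀ {x y} → 0ℚ ℚ.≤ y ℚ.- x → x ℚ.≤ y
0≤-⇒≤ {x} {y} h = subst₂ ℚ._≤_ (ℚP.+-identityˡ x) (solve 2 (λ x y → y :- x :+ x := y) refl x y) (ℚP.+-monoˡ-≤ x h)
  where open ℚS.+-*-Solver

≤⇒0≤- : ∀ {x y} → x ℚ.≤ y → 0ℚ ℚ.≤ y ℚ.- x
≤⇒0≤- {x} {y} h = subst (ℚ._≤ y ℚ.- x) (ℚP.+-inverseʳ x) (ℚP.+-monoˡ-≤ (ℚ.- x) h)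

p≤∣p∣ : ∀ p → p ℚ.≤ ℚ.∣ p ∣
p≤∣p∣ p with ℚP.≤-total 0ℚ p
... | inj₁ 0≤p = ℚP.≤-reflexive (sym (ℚP.0≤p⇒∣p∣≡p 0≤p))
... | inj₂ p≤0 = ℚP.≤-trans p≤0 (ℚP.0≤∣p∣ p)

-p≤∣p∣ : ∀ p → ℚ.- p ℚ.≤ ℚ.∣ p ∣
-p≤∣p∣ p = subst (ℚ.- p ℚ.≤_) (ℚP.∣-p∣≡∣p∣ p) (p≤∣p∣ (ℚ.- p))

neg-cancel-≤ : ∀ {x y} → ℚ.- x ℚ.≤ ℚ.- y → y ℚ.≤ x
neg-cancel-≤ {x} {y} h = subst₂ ℚ._≤_ (neg-neg y) (neg-neg x) (ℚP.neg-antimono-≤ h)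
  where
  open ℚS.+-*-Solver
  neg-neg : ∀ z → ℚ.- (ℚ.- z) ≡ z
  neg-neg = solve 1 (λ z → :- (:- z) := z) refl

-∣p∣≤p : ∀ p → ℚ.- ℚ.∣ p ∣ ℚ.≤ p
-∣p∣≤p p = neg-cancel-≤ (subst (ℚ.- p ℚ.≤_) (solve 1 (λ z → z := :- (:- z)) refl ℚ.∣ p ∣) (-p≤∣p∣ p))
  where open ℚS.+-*-Solver

∣p∣≤ : ∀ {p r} → p ℚ.≤ r → ℚ.- p ℚ.≤ r → ℚ.∣ p ∣ ℚ.≤ r
∣p∣≤ {p} p≤ -p≤ with ℚP.∣p∣≡p∨∣p∣≡-p p
... | inj₁ eq = subst (ℚ._≤ _) (sym eq) p≤
... | inj₂ eq = subst (ℚ._≤ _) (sym eq) -p≤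

sumℚ-mono : {f g : Fin n → ℚ} → (∀ i → f i ℚ.≤ g i) → sumℚ f ℚ.≤ sumℚ g
sumℚ-mono {zero}  h = ℚP.≤-refl
sumℚ-mono {suc n} h = ℚP.+-mono-≤ (h zero) (sumℚ-mono (h ∘ suc))

sumℚ-zero : ∀ n → sumℚ {n} (λ _ → 0ℚ) ≡ 0ℚ
sumℚ-zero zero    = refl
sumℚ-zero (suc n) = trans (ℚP.+-identityˡ _) (sumℚ-zero n)

sumℚ-nonneg : {f : Fin n → ℚ} → (∀ i → 0ℚ ℚ.≤ f i) → 0ℚ ℚ.≤ sumℚ f
sumℚ-nonneg {n} {f} h = subst (ℚ._≤ sumℚ f) (sumℚ-zero n) (sumℚ-mono h)

termℚ≤sum : {f : Fin n → ℚ} → (∀ i → 0ℚ ℚ.≤ f i) → ∀ i → f i ℚ.≤ sumℚ f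
termℚ≤sum {f = f} h zero    = subst (ℚ._≤ sumℚ f) (ℚP.+-identityʳ _) (ℚP.+-monoʳ-≤ (f zero) (sumℚ-nonneg (h ∘ suc)))
termℚ≤sum {f = f} h (suc i) = ℚP.≤-trans (termℚ≤sum (h ∘ suc) i)
  (subst (ℚ._≤ sumℚ f) (ℚP.+-identityˡ _) (ℚP.+-monoˡ-≤ (sumℚ (f ∘ suc)) (h zero)))

sumℚ-single : {f : Fin n → ℚ} (i : Fin n) → (∀ j → j ≢ i → f j ≡ 0ℚ) → sumℚ f ≡ f i
sumℚ-single {suc n} {f} zero h =
  trans (cong (f zero ℚ.+_) (trans (sumℚ-cong λ j → h (suc j) λ ()) (sumℚ-zero n))) (ℚP.+-identityʳ _)
sumℚ-single (suc i) h = trans (cong₂ ℚ._+_ (h zero λ ()) (sumℚ-single i λ j j≢i → h (suc j) λ { refl → j≢i refl })) (ℚP.+-identityˡ _)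

Eventually : (ℕ → Set) → Set
Eventually P = ∃[ N ] (∀ m → N ℕ.≤ m → P m)

both : {P Q : ℕ → Set} → Eventually P → Eventually Q → Eventually (λ m → P m × Q m)
both (N , p) (M , r) = N ℕ.⊔ M , λ m m≥ → p m (CauchyLemmas.≤⊔ˡ N M m≥) , r m (CauchyLemmas.≤⊔ʳ N M m≥)

always : {P : ℕ → Set} → (∀ m → P m) → Eventually P
always p = 0 , λ m _ → p m

eventually-map : {P Q : ℕ → Set} → (∀ m → P m → Q m) → Eventually P → Eventually Q
eventually-map f (N , p) = N , λ m m≥ → f m (p m m≥)

-- A positive form of 0ᴿ ≤ᴿ x.
Nonneg : ℝ → Set
Nonneg x = ∀ ε → 0ℚ ℚ.< ε → Eventually λ m → ℚ.- ε ℚ.≤ seq x m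

Nonneg-mono : ∀ x y → Eventually (λ m → seq x m ℚ.≤ seq y m) → Nonneg x → Nonneg y
Nonneg-mono _ _ x≤y nx ε 0<ε = eventually-map (λ m (l , r) → ℚP.≤-trans l r) (both (nx ε 0<ε) x≤y)

Nonneg-≡ : ∀ x y → (∀ m → seq x m ≡ seq y m) → Nonneg x → Nonneg y
Nonneg-≡ x y eq = Nonneg-mono x y (always (ℚP.≤-reflexive ∘ eq))

eventually⇒Nonneg : ∀ x → Eventually (λ m → 0ℚ ℚ.≤ seq x m) → Nonneg x
eventually⇒Nonneg _ h ε 0<ε = eventually-map (λ m → ℚP.≤-trans (ℚP.<⇒≤ (ℚP.neg-antimono-< 0<ε))) h

Nonneg-+ : ∀ x y → Nonneg x → Nonneg y → Nonneg (x +ᴿ y)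
Nonneg-+ x y nx ny ε 0<ε = eventually-map
  (λ m (l , r) → ℚP.≤-trans (ℚP.≤-reflexive (trans (cong ℚ.-_ (sym (halves ε))) (ℚP.neg-distrib-+ (½ ℚ.* ε) (½ ℚ.* ε)))) (ℚP.+-mono-≤ l r))
  (both (nx (½ ℚ.* ε) (half-pos ε 0<ε)) (ny (½ ℚ.* ε) (half-pos ε 0<ε)))
  where open CauchyLemmas

Nonneg-∑ : (f : Fin n → ℝ) → (∀ i → Nonneg (f i)) → Nonneg (∑ f)
Nonneg-∑ {zero}  f h = eventually⇒Nonneg 0ᴿ (always λ _ → ℚP.≤-refl)
Nonneg-∑ {suc n} f h = Nonneg-+ (f zero) (∑ (f ∘ suc)) (h zero) (Nonneg-∑ (f ∘ suc) (h ∘ suc))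

natᴿ : ℕ → ℝ
natᴿ m = fromℚ (toℚ m)

Nonneg-natᴿ : ∀ m → Nonneg (natᴿ m)
Nonneg-natᴿ m = eventually⇒Nonneg (natᴿ m) (always λ _ → 0≤toℚ m)

-- In each sign case xy + (B + K)η is a sum of products of nonnegative rationals; a factor may be
-- negative, but not below -η, and the other is bounded by B or K.
*-lower : ∀ {x y B K η} → ℚ.∣ x ∣ ℚ.≤ B → ℚ.∣ y ∣ ℚ.≤ K → 0ℚ ℚ.≤ η → ℚ.- η ℚ.≤ x → ℚ.- η ℚ.≤ y →
  ℚ.- ((B ℚ.+ K) ℚ.* η) ℚ.≤ x ℚ.* y
*-lower {x} {y} {B} {K} {η} x≤B y≤K 0≤η lx ly = 0≤-⇒≤ (cases (ℚP.≤-total 0ℚ x) (ℚP.≤-total 0ℚ y))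
  where
  open ℚS.+-*-Solver
  0≤B : 0ℚ ℚ.≤ B
  0≤B = ℚP.≤-trans (ℚP.0≤∣p∣ x) x≤B
  0≤K : 0ℚ ℚ.≤ K
  0≤K = ℚP.≤-trans (ℚP.0≤∣p∣ y) y≤K
  0≤x+η : 0ℚ ℚ.≤ x ℚ.- (ℚ.- η)
  0≤x+η = ≤⇒0≤- lx
  0≤y+η : 0ℚ ℚ.≤ y ℚ.- (ℚ.- η)
  0≤y+η = ≤⇒0≤- ly
  0≤B-x : 0ℚ ℚ.≤ B ℚ.- x
  0≤B-x = ≤⇒0≤- (ℚP.≤-trans (p≤∣p∣ x) x≤B)
  0≤K-y : 0ℚ ℚ.≤ K ℚ.- y
  0≤K-y = ≤⇒0≤- (ℚP.≤-trans (p≤∣p∣ y) y≤K)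
  cases : 0ℚ ℚ.≤ x ⊎ x ℚ.≤ 0ℚ → 0ℚ ℚ.≤ y ⊎ y ℚ.≤ 0ℚ → 0ℚ ℚ.≤ x ℚ.* y ℚ.- (ℚ.- ((B ℚ.+ K) ℚ.* η))
  cases (inj₁ 0≤x) _ = subst (0ℚ ℚ.≤_)
    (solve 5 (λ x y B K η → x :* (y :- (:- η)) :+ (B :- x) :* η :+ K :* η := x :* y :- (:- ((B :+ K) :* η))) refl x y B K η)
    (ℚP.+-mono-≤ (ℚP.+-mono-≤ (0≤* 0≤x 0≤y+η) (0≤* 0≤B-x 0≤η)) (0≤* 0≤K 0≤η))
  cases (inj₂ _) (inj₁ 0≤y) = subst (0ℚ ℚ.≤_)
    (solve 5 (λ x y B K η → y :* (x :- (:- η)) :+ (K :- y) :* η :+ B :* η := x :* y :- (:- ((B :+ K) :* η))) refl x y B K η)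
    (ℚP.+-mono-≤ (ℚP.+-mono-≤ (0≤* 0≤y 0≤x+η) (0≤* 0≤K-y 0≤η)) (0≤* 0≤B 0≤η))
  cases (inj₂ x≤0) (inj₂ y≤0) = subst (0ℚ ℚ.≤_)
    (solve 5 (λ x y B K η → (con 0ℚ :- x) :* (con 0ℚ :- y) :+ B :* η :+ K :* η := x :* y :- (:- ((B :+ K) :* η))) refl x y B K η)
    (ℚP.+-mono-≤ (ℚP.+-mono-≤ (0≤* (≤⇒0≤- x≤0) (≤⇒0≤- y≤0)) (0≤* 0≤B 0≤η)) (0≤* 0≤K 0≤η))

Nonneg-* : ∀ x y → Nonneg x → Nonneg y → Nonneg (x *ᴿ y)
Nonneg-* x y nx ny ε 0<ε =
  let N₁ , B , 0<B , x≤B = bounded (seq x) (cauchy x)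
      N₂ , K , 0<K , y≤K = bounded (seq y) (cauchy y)
      η , 0<η , eq = *-shrink (B ℚ.+ K) ε (ℚP.+-mono-< 0<B 0<K) 0<ε
  in eventually-map (λ m ((x≤ , y≤) , (lx , ly)) →
       subst (λ z → ℚ.- z ℚ.≤ seq x m ℚ.* seq y m) eq (*-lower x≤ y≤ (ℚP.<⇒≤ 0<η) lx ly))
     (both (both (N₁ , x≤B) (N₂ , y≤K)) (both (nx η 0<η) (ny η 0<η)))
  where open CauchyLemmas

≃⇒Nonneg : ∀ x y → x ≃ y → Nonneg (x -ᴿ y)
≃⇒Nonneg x y x≃y ε 0<ε = eventually-map
  (λ m h → ℚP.≤-trans (ℚP.neg-antimono-≤ (ℚP.<⇒≤ h)) (-∣p∣≤p (seq x m ℚ.- seq y m))) (x≃y ε 0<ε)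

Nonneg⇒positive : ∀ x e → 0ℚ ℚ.< e → Nonneg (x -ᴿ fromℚ e) → Eventually λ m → 0ℚ ℚ.< seq x m
Nonneg⇒positive x e 0<e nx = eventually-map (λ m h → ℚP.<-≤-trans (half-pos e 0<e)
    (subst₂ ℚ._≤_ (solve 1 (λ e → :- (con ½ :* e) :+ e := con ½ :* e) refl e)
      (solve 2 (λ x e → x :- e :+ e := x) refl (seq x m) e) (ℚP.+-monoˡ-≤ e h)))
  (nx (½ ℚ.* e) (half-pos e 0<e))
  where open ℚS.+-*-Solver
        open CauchyLemmas using (half-pos)

-- A comparison at one sufficiently late rational term x̂ is decidable, and this makes the negation
-- usable. With tolerance ε/4, x̂ < -ε + ε/4 would keep all later terms below -ε/2, so that x < 0
-- with margin ε/4.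
0≤ᴿ⇒Nonneg : ∀ x → 0ᴿ ≤ᴿ x → Nonneg x
0≤ᴿ⇒Nonneg x x≮0 ε 0<ε = eventually-map
    (λ m close → ℚP.≤-trans far (lower m close)) start
  where
  open ℚS.+-*-Solver
  open CauchyLemmas using (half-pos)
  e₁ e₂ : ℚ
  e₁ = ½ ℚ.* ε
  e₂ = ½ ℚ.* e₁
  0<e₂ = half-pos e₁ (half-pos ε 0<ε)
  N = proj₁ (cauchy x e₂ 0<e₂)
  x̂ = seq x N
  start : Eventually λ m → ℚ.∣ seq x m ℚ.- x̂ ∣ ℚ.≤ e₂
  start = N , λ m m≥ → ℚP.<⇒≤ (proj₂ (cauchy x e₂ 0<e₂) m N m≥ ℕP.≤-refl)
  lower : ∀ m → ℚ.∣ seq x m ℚ.- x̂ ∣ ℚ.≤ e₂ → x̂ ℚ.- e₂ ℚ.≤ seq x m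
  lower m close = subst₂ ℚ._≤_ (ℚP.+-comm (ℚ.- e₂) x̂) (solve 2 (λ a b → a :- b :+ b := a) refl (seq x m) x̂)
    (ℚP.+-monoˡ-≤ x̂ (ℚP.≤-trans (ℚP.neg-antimono-≤ close) (-∣p∣≤p _)))
  upper : ∀ m → ℚ.∣ seq x m ℚ.- x̂ ∣ ℚ.≤ e₂ → seq x m ℚ.≤ x̂ ℚ.+ e₂
  upper m close = subst₂ ℚ._≤_ (solve 2 (λ a b → a :- b :+ b := a) refl (seq x m) x̂) (ℚP.+-comm e₂ x̂)
    (ℚP.+-monoˡ-≤ x̂ (ℚP.≤-trans (p≤∣p∣ _) close))
  far : ℚ.- ε ℚ.≤ x̂ ℚ.- e₂
  far = ℚP.≮⇒≥ λ x̂< → x≮0 (e₂ , 0<e₂ , eventually-map (λ m close → ℚP.≤-trans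
      (ℚP.+-monoˡ-≤ e₂ (upper m close))
      (ℚP.≤-trans (ℚP.≤-reflexive (solve 2 (λ a e → a :+ con ½ :* (con ½ :* e) :+ con ½ :* (con ½ :* e)
          := a :- con ½ :* (con ½ :* e) :+ (con ½ :* e :+ con ½ :* (con ½ :* e))) refl x̂ ε))
        (ℚP.≤-trans (ℚP.+-monoˡ-≤ _ (ℚP.<⇒≤ x̂<))
          (ℚP.≤-trans (ℚP.≤-reflexive (solve 1 (λ e → :- e :+ (con ½ :* e :+ con ½ :* (con ½ :* e)) := :- (con ½ :* (con ½ :* e))) refl ε))
            (ℚP.<⇒≤ (ℚP.neg-antimono-< 0<e₂)))))) start)

-- Absolute values and sums, index by index

absᴿ : ℝ → ℝ
absᴿ x = mkℝ (λ m → ℚ.∣ seq x m ∣) λ ε 0<ε → let N , h = cauchy x ε 0<ε in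
  N , λ m k m≥ k≥ → ℚP.≤-<-trans (reverse-triangle (seq x m) (seq x k)) (h m k m≥ k≥)
  where
  open ℚS.+-*-Solver
  half : ∀ a b → ℚ.∣ a ∣ ℚ.- ℚ.∣ b ∣ ℚ.≤ ℚ.∣ a ℚ.- b ∣
  half a b = subst₂ ℚ._≤_ refl (solve 2 (λ c d → c :+ d :- d := c) refl ℚ.∣ a ℚ.- b ∣ ℚ.∣ b ∣)
    (ℚP.+-monoˡ-≤ (ℚ.- ℚ.∣ b ∣) (subst (λ z → ℚ.∣ z ∣ ℚ.≤ ℚ.∣ a ℚ.- b ∣ ℚ.+ ℚ.∣ b ∣) (sym (CauchyLemmas.sub-add a b))
      (ℚP.∣p+q∣≤∣p∣+∣q∣ (a ℚ.- b) b)))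
  reverse-triangle : ∀ a b → ℚ.∣ ℚ.∣ a ∣ ℚ.- ℚ.∣ b ∣ ∣ ℚ.≤ ℚ.∣ a ℚ.- b ∣
  reverse-triangle a b = ∣p∣≤ (half a b) (subst₂ ℚ._≤_
    (solve 2 (λ c d → d :- c := :- (c :- d)) refl ℚ.∣ a ∣ ℚ.∣ b ∣)
    (trans (cong ℚ.∣_∣ (solve 2 (λ a b → b :- a := :- (a :- b)) refl a b)) (ℚP.∣-p∣≡∣p∣ (a ℚ.- b)))
    (half b a))

seq-∑ : (f : Fin n → ℝ) (m : ℕ) → seq (∑ f) m ≡ sumℚ (λ i → seq (f i) m)
seq-∑ {zero}  f m = refl
seq-∑ {suc n} f m = cong (seq (f zero) m ℚ.+_) (seq-∑ (f ∘ suc) m)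

seq-weighted : (e : Fin n → ℕ) (x : Fin n → ℝ) (m : ℕ) →
  seq (∑ (λ j → natᴿ (e j) *ᴿ absᴿ (x j))) m ≡ sumℚ (λ j → toℚ (e j) ℚ.* ℚ.∣ seq (x j) m ∣)
seq-weighted e x m = seq-∑ (λ j → natᴿ (e j) *ᴿ absᴿ (x j)) m

-- The spectral bound

module Identity (G : Graph n) (y : Fin n → ℚ) (α μ : ℚ) where
  open Degrees G
  open ℚS.+-*-Solver

  β : ℚ
  β = 1ℚ ℚ.- α

  ā : Fin n → Fin n → ℚ
  ā i j = toℚ (edge i j)

  qd : Fin n → ℚ
  qd i = toℚ (d i)

  -- Coordinate i of (B - μI)y for B = A_α, at one index of the Cauchy sequences.
  defect : Fin n → ℚ
  defect i = α ℚ.* (qd i ℚ.* y i) ℚ.+ β ℚ.* sumℚ (λ j → ā i j ℚ.* y j) ℚ.- μ ℚ.* y i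

  weighted-defect : (e : Fin n → ℚ) → sumℚ (λ i → e i ℚ.* defect i) ≡
    sumℚ (λ j → e j ℚ.* (α ℚ.* (qd j ℚ.* y j) ℚ.- μ ℚ.* y j) ℚ.+ β ℚ.* (sumℚ (λ i → e i ℚ.* ā i j) ℚ.* y j))
  weighted-defect e = begin
    sumℚ (λ i → e i ℚ.* defect i)
      ≡⟨ sumℚ-cong (λ i → solve 5 (λ e p b s m → e :* (p :+ b :* s :- m) := e :* (p :- m) :+ b :* (e :* s))
           refl (e i) (α ℚ.* (qd i ℚ.* y i)) β (sumℚ (λ j → ā i j ℚ.* y j)) (μ ℚ.* y i)) ⟩
    sumℚ (λ i → own i ℚ.+ β ℚ.* (e i ℚ.* sumℚ (λ j → ā i j ℚ.* y j)))
      ≡⟨ trans (sumℚ-distrib-+ own _) (cong (sumℚ own ℚ.+_) (sym (*-distribˡ-sumℚ {n} β (λ i → e i ℚ.* sumℚ (λ j → ā i j ℚ.* y j))))) ⟩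
    sumℚ own ℚ.+ β ℚ.* sumℚ (λ i → e i ℚ.* sumℚ (λ j → ā i j ℚ.* y j))
      ≡⟨ cong (λ z → sumℚ own ℚ.+ β ℚ.* z) swap ⟩
    sumℚ own ℚ.+ β ℚ.* sumℚ (λ j → sumℚ (λ i → e i ℚ.* ā i j) ℚ.* y j)
      ≡⟨ trans (cong (sumℚ own ℚ.+_) (*-distribˡ-sumℚ {n} β (λ j → sumℚ (λ i → e i ℚ.* ā i j) ℚ.* y j))) (sym (sumℚ-distrib-+ own _)) ⟩
    sumℚ (λ j → own j ℚ.+ β ℚ.* (sumℚ (λ i → e i ℚ.* ā i j) ℚ.* y j)) ∎
    where
    open ≡-Reasoning
    own : Fin n → ℚ
    own i = e i ℚ.* (α ℚ.* (qd i ℚ.* y i) ℚ.- μ ℚ.* y i)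
    swap : sumℚ (λ i → e i ℚ.* sumℚ (λ j → ā i j ℚ.* y j)) ≡ sumℚ (λ j → sumℚ (λ i → e i ℚ.* ā i j) ℚ.* y j)
    swap = begin
      sumℚ (λ i → e i ℚ.* sumℚ (λ j → ā i j ℚ.* y j))
        ≡⟨ sumℚ-cong (λ i → trans (*-distribˡ-sumℚ {n} (e i) (λ j → ā i j ℚ.* y j)) (sumℚ-cong λ j → sym (ℚP.*-assoc (e i) (ā i j) (y j)))) ⟩
      sumℚ (λ i → sumℚ (λ j → e i ℚ.* ā i j ℚ.* y j))
        ≡⟨ sumℚ-comm (λ i j → e i ℚ.* ā i j ℚ.* y j) ⟩
      sumℚ (λ j → sumℚ (λ i → e i ℚ.* ā i j ℚ.* y j))
        ≡⟨ sumℚ-cong (λ j → sym (*-distribʳ-sumℚ {n} (y j) (λ i → e i ℚ.* ā i j))) ⟩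
      sumℚ (λ j → sumℚ (λ i → e i ℚ.* ā i j) ℚ.* y j) ∎

  neighbourDegrees : Fin n → ℕ
  neighbourDegrees j = sum (λ i → d i ℕ.* edge i j)

  sum-defect : sumℚ defect ≡ sumℚ (λ j → α ℚ.* (qd j ℚ.* y j) ℚ.- μ ℚ.* y j ℚ.+ β ℚ.* (qd j ℚ.* y j))
  sum-defect = trans (sumℚ-cong λ i → sym (ℚP.*-identityˡ (defect i)))
    (trans (weighted-defect (λ _ → 1ℚ)) (sumℚ-cong λ j → cong₂ ℚ._+_ (ℚP.*-identityˡ (α ℚ.* (qd j ℚ.* y j) ℚ.- μ ℚ.* y j))
      (cong (λ z → β ℚ.* (z ℚ.* y j)) (trans (sumℚ-cong λ i → trans (ℚP.*-identityˡ (ā i j)) (cong toℚ (edge-sym i j)))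
        (trans (sym (toℚ-sum (edge j))) (cong toℚ (sym (degree≡sum j))))))))

  degree-weighted-defect : sumℚ (λ i → qd i ℚ.* defect i) ≡
    sumℚ (λ j → qd j ℚ.* (α ℚ.* (qd j ℚ.* y j) ℚ.- μ ℚ.* y j) ℚ.+ β ℚ.* (toℚ (neighbourDegrees j) ℚ.* y j))
  degree-weighted-defect = trans (weighted-defect qd) (sumℚ-cong λ j →
    cong (λ z → qd j ℚ.* (α ℚ.* (qd j ℚ.* y j) ℚ.- μ ℚ.* y j) ℚ.+ β ℚ.* (z ℚ.* y j))
      (trans (sumℚ-cong λ i → sym (toℚ-* (d i) (edge i j))) (sym (toℚ-sum (λ i → d i ℕ.* edge i j)))))

  module _ {δ H : ℕ} (r r′ : Fin n → ℕ)
    (r′-def : ∀ i → d i ℕ.+ 1 ℕ.+ r′ i ≡ n)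
    (r-def : ∀ j → neighbourDegrees j ℕ.+ d j ℕ.+ n ℕ.* δ ℕ.+ r j ≡ H ℕ.+ δ ℕ.+ d j ℕ.* δ) where

    b c : ℚ
    b = toℚ δ ℚ.+ α ℚ.* toℚ n ℚ.- α ℚ.* toℚ δ ℚ.- 1ℚ
    c = β ℚ.* (toℚ H ℚ.- toℚ (n ℕ.* δ) ℚ.+ toℚ δ)

    -- The column sums of B are the degrees, as αd + (1 - α)d = d. So the left side is 1ᵀ(B + (μ -
    -- b)I)(B - μI)y plus slack, and coefficients of `y i` are compared. With b = α(n - 1) + (1 -
    -- α)(δ - 1), the α-part matches through `r′ i` = n - 1 - d(i), the rest through the slack `r i`
    -- of the neighbour degree sum.
    defect-identity :
      sumℚ (λ i → qd i ℚ.* defect i) ℚ.+ α ℚ.* sumℚ (λ i → toℚ (d i ℕ.* r′ i) ℚ.* y i)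
        ℚ.+ β ℚ.* sumℚ (λ i → toℚ (r i) ℚ.* y i) ℚ.+ (μ ℚ.- b) ℚ.* sumℚ defect
      ≡ (c ℚ.- (μ ℚ.- b) ℚ.* μ) ℚ.* sumℚ y
    defect-identity = begin
      sumℚ (λ i → qd i ℚ.* defect i) ℚ.+ α ℚ.* sumℚ B ℚ.+ β ℚ.* sumℚ C ℚ.+ (μ ℚ.- b) ℚ.* sumℚ defect
        ≡⟨ cong₂ (λ a e → a ℚ.+ α ℚ.* sumℚ B ℚ.+ β ℚ.* sumℚ C ℚ.+ (μ ℚ.- b) ℚ.* e) degree-weighted-defect sum-defect ⟩
      sumℚ A ℚ.+ α ℚ.* sumℚ B ℚ.+ β ℚ.* sumℚ C ℚ.+ (μ ℚ.- b) ℚ.* sumℚ D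
        ≡⟨ trans (cong₂ ℚ._+_ (trans (cong₂ ℚ._+_ (trans (cong (sumℚ A ℚ.+_) (*-distribˡ-sumℚ α B)) (sym (sumℚ-distrib-+ A _)))
             (*-distribˡ-sumℚ β C)) (sym (sumℚ-distrib-+ (λ i → A i ℚ.+ α ℚ.* B i) _)))
             (*-distribˡ-sumℚ (μ ℚ.- b) D)) (sym (sumℚ-distrib-+ (λ i → A i ℚ.+ α ℚ.* B i ℚ.+ β ℚ.* C i) _)) ⟩
      sumℚ (λ i → A i ℚ.+ α ℚ.* B i ℚ.+ β ℚ.* C i ℚ.+ (μ ℚ.- b) ℚ.* D i)
        ≡⟨ sumℚ-cong pointwise ⟩
      sumℚ (λ i → (c ℚ.- (μ ℚ.- b) ℚ.* μ) ℚ.* y i)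
        ≡⟨ *-distribˡ-sumℚ (c ℚ.- (μ ℚ.- b) ℚ.* μ) y ⟨
      (c ℚ.- (μ ℚ.- b) ℚ.* μ) ℚ.* sumℚ y ∎
      where
      open ≡-Reasoning
      A B C D : Fin n → ℚ
      A j = qd j ℚ.* (α ℚ.* (qd j ℚ.* y j) ℚ.- μ ℚ.* y j) ℚ.+ β ℚ.* (toℚ (neighbourDegrees j) ℚ.* y j)
      B i = toℚ (d i ℕ.* r′ i) ℚ.* y i
      C i = toℚ (r i) ℚ.* y i
      D j = α ℚ.* (qd j ℚ.* y j) ℚ.- μ ℚ.* y j ℚ.+ β ℚ.* (qd j ℚ.* y j)
      r′≡ : ∀ i → toℚ n ≡ qd i ℚ.+ 1ℚ ℚ.+ toℚ (r′ i)
      r′≡ i = trans (cong toℚ (sym (r′-def i))) (trans (toℚ-+ (d i ℕ.+ 1) (r′ i)) (cong (ℚ._+ toℚ (r′ i)) (trans (toℚ-+ (d i) 1) (cong (qd i ℚ.+_) (toℚ-def 1)))))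
      r≡ : ∀ j → toℚ H ≡ toℚ (neighbourDegrees j) ℚ.+ qd j ℚ.+ toℚ (n ℕ.* δ) ℚ.+ toℚ (r j) ℚ.- (toℚ δ ℚ.+ qd j ℚ.* toℚ δ)
      r≡ j = trans (solve 3 (λ h a b → h := h :+ a :+ b :- (a :+ b)) refl (toℚ H) (toℚ δ) (qd j ℚ.* toℚ δ))
        (cong (ℚ._- (toℚ δ ℚ.+ qd j ℚ.* toℚ δ)) (trans (sym (trans (toℚ-+ (H ℕ.+ δ) (d j ℕ.* δ)) (cong₂ ℚ._+_ (toℚ-+ H δ) (toℚ-* (d j) δ))))
          (trans (cong toℚ (sym (r-def j))) (trans (toℚ-+ (neighbourDegrees j ℕ.+ d j ℕ.+ n ℕ.* δ) (r j)) (cong (ℚ._+ toℚ (r j))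
            (trans (toℚ-+ (neighbourDegrees j ℕ.+ d j) (n ℕ.* δ)) (cong (ℚ._+ toℚ (n ℕ.* δ)) (toℚ-+ (neighbourDegrees j) (d j)))))))))
      pointwise : ∀ i → A i ℚ.+ α ℚ.* B i ℚ.+ β ℚ.* C i ℚ.+ (μ ℚ.- b) ℚ.* D i ≡ (c ℚ.- (μ ℚ.- b) ℚ.* μ) ℚ.* y i
      pointwise i = begin
        A i ℚ.+ α ℚ.* B i ℚ.+ β ℚ.* C i ℚ.+ (μ ℚ.- b) ℚ.* D i
          ≡⟨ cong₂ ℚ._+_ (cong₂ ℚ._+_ (cong₂ ℚ._+_ A≡ B≡) C≡) (cong ((μ ℚ.- b) ℚ.*_) D≡) ⟩
        (α ℚ.* (e ℚ.* e) ℚ.- e ℚ.* μ ℚ.+ β ℚ.* w) ℚ.* y i ℚ.+ α ℚ.* (e ℚ.* toℚ (r′ i)) ℚ.* y i ℚ.+ β ℚ.* toℚ (r i) ℚ.* y i ℚ.+ (μ ℚ.- b) ℚ.* ((e ℚ.- μ) ℚ.* y i)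
          ≡⟨ solve 8 (λ s₁ s₂ s₃ s₄ e μ b y → (s₁ :- e :* μ :+ s₂) :* y :+ s₃ :* y :+ s₄ :* y :+ (μ :- b) :* ((e :- μ) :* y)
               := (s₁ :+ s₂ :+ s₃ :+ s₄ :- b :* e :- (μ :- b) :* μ) :* y)
               refl (α ℚ.* (e ℚ.* e)) (β ℚ.* w) (α ℚ.* (e ℚ.* toℚ (r′ i))) (β ℚ.* toℚ (r i)) e μ b (y i) ⟩
        (α ℚ.* (e ℚ.* e) ℚ.+ β ℚ.* w ℚ.+ α ℚ.* (e ℚ.* toℚ (r′ i)) ℚ.+ β ℚ.* toℚ (r i) ℚ.- b ℚ.* e ℚ.- (μ ℚ.- b) ℚ.* μ) ℚ.* y i
          ≡⟨ cong (λ z → (z ℚ.- (μ ℚ.- b) ℚ.* μ) ℚ.* y i) coefficient ⟩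
        (c ℚ.- (μ ℚ.- b) ℚ.* μ) ℚ.* y i ∎
        where
        e w : ℚ
        e = qd i
        w = toℚ (neighbourDegrees i)
        A≡ : A i ≡ (α ℚ.* (e ℚ.* e) ℚ.- e ℚ.* μ ℚ.+ β ℚ.* w) ℚ.* y i
        A≡ = solve 6 (λ α e μ y β w → e :* (α :* (e :* y) :- μ :* y) :+ β :* (w :* y) := (α :* (e :* e) :- e :* μ :+ β :* w) :* y)
          refl α e μ (y i) β w
        B≡ : α ℚ.* B i ≡ α ℚ.* (e ℚ.* toℚ (r′ i)) ℚ.* y i
        B≡ = trans (cong (λ z → α ℚ.* (z ℚ.* y i)) (toℚ-* (d i) (r′ i))) (sym (ℚP.*-assoc α _ (y i)))
        C≡ : β ℚ.* C i ≡ β ℚ.* toℚ (r i) ℚ.* y i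
        C≡ = sym (ℚP.*-assoc β _ (y i))
        D≡ : D i ≡ (e ℚ.- μ) ℚ.* y i
        D≡ = solve 4 (λ α e μ y → α :* (e :* y) :- μ :* y :+ (con 1ℚ :- α) :* (e :* y) := (e :- μ) :* y) refl α e μ (y i)
        b≡ : b ≡ α ℚ.* (e ℚ.+ toℚ (r′ i)) ℚ.+ β ℚ.* (toℚ δ ℚ.- 1ℚ)
        b≡ = trans (cong (λ N → toℚ δ ℚ.+ α ℚ.* N ℚ.- α ℚ.* toℚ δ ℚ.- 1ℚ) (r′≡ i))
          (solve 4 (λ α e r δ → δ :+ α :* (e :+ con 1ℚ :+ r) :- α :* δ :- con 1ℚ
            := α :* (e :+ r) :+ (con 1ℚ :- α) :* (δ :- con 1ℚ)) refl α e (toℚ (r′ i)) (toℚ δ))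
        c≡ : c ≡ β ℚ.* (w ℚ.+ e ℚ.+ toℚ (r i) ℚ.- e ℚ.* toℚ δ)
        c≡ = cong (β ℚ.*_) (trans (cong (λ h → h ℚ.- toℚ (n ℕ.* δ) ℚ.+ toℚ δ) (r≡ i))
          (solve 5 (λ w e m r δ → w :+ e :+ m :+ r :- (δ :+ e :* δ) :- m :+ δ := w :+ e :+ r :- e :* δ)
            refl w e (toℚ (n ℕ.* δ)) (toℚ (r i)) (toℚ δ)))
        coefficient : α ℚ.* (e ℚ.* e) ℚ.+ β ℚ.* w ℚ.+ α ℚ.* (e ℚ.* toℚ (r′ i)) ℚ.+ β ℚ.* toℚ (r i) ℚ.- b ℚ.* e ≡ c
        coefficient = trans (cong (λ z → α ℚ.* (e ℚ.* e) ℚ.+ β ℚ.* w ℚ.+ α ℚ.* (e ℚ.* toℚ (r′ i)) ℚ.+ β ℚ.* toℚ (r i) ℚ.- z ℚ.* e) b≡)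
          (trans (solve 7 (λ α β e w r r′ δ → α :* (e :* e) :+ β :* w :+ α :* (e :* r′) :+ β :* r
              :- (α :* (e :+ r′) :+ β :* (δ :- con 1ℚ)) :* e := β :* (w :+ e :+ r :- e :* δ))
            refl α β e w (toℚ (r i)) (toℚ (r′ i)) (toℚ δ)) (sym c≡))

  module _ (x : Fin n → ℚ) (0≤β : 0ℚ ℚ.≤ β) (y-abs : ∀ j → y j ≡ ℚ.∣ x j ∣) where

    -- Multiply row i of the approximate eigenvalue equation by the sign σ of `x i`. The diagonal
    -- and μ terms become those of y, and the adjacency terms can only be smaller than those of y,
    -- because σx(j) ≤ |x(j)| and β ≥ 0. The sign is that of a rational term and may vary along the
    -- sequence.
    defect≥ : ∀ {ε} i →
      ℚ.∣ α ℚ.* (qd i ℚ.* x i) ℚ.+ β ℚ.* sumℚ (λ j → ā i j ℚ.* x j) ℚ.- μ ℚ.* x i ∣ ℚ.≤ ε → ℚ.- ε ℚ.≤ defect i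
    defect≥ {ε} i err≤ = signed (ℚP.∣p∣≡p∨∣p∣≡-p (x i))
      where
      err : ℚ
      err = α ℚ.* (qd i ℚ.* x i) ℚ.+ β ℚ.* sumℚ (λ j → ā i j ℚ.* x j) ℚ.- μ ℚ.* x i
      -- σ is the sign of x i.
      with-sign : ∀ σ → y i ≡ σ ℚ.* x i → (∀ j → σ ℚ.* x j ℚ.≤ y j) → ℚ.- ε ℚ.≤ σ ℚ.* err → ℚ.- ε ℚ.≤ defect i
      with-sign σ yi≡ ≤y lower = ℚP.≤-trans lower (subst (σ ℚ.* err ℚ.≤_) (sym split)
        (subst (ℚ._≤ σ ℚ.* err ℚ.+ β ℚ.* sumℚ (λ j → ā i j ℚ.* (y j ℚ.- σ ℚ.* x j))) (ℚP.+-identityʳ _)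
          (ℚP.+-monoʳ-≤ (σ ℚ.* err) (0≤* 0≤β (sumℚ-nonneg λ j → 0≤* (0≤toℚ (edge i j)) (≤⇒0≤- (≤y j)))))))
        where
        split : defect i ≡ σ ℚ.* err ℚ.+ β ℚ.* sumℚ (λ j → ā i j ℚ.* (y j ℚ.- σ ℚ.* x j))
        split = begin
          α ℚ.* (qd i ℚ.* y i) ℚ.+ β ℚ.* sumℚ (λ j → ā i j ℚ.* y j) ℚ.- μ ℚ.* y i
            ≡⟨ cong₂ (λ z s → α ℚ.* (qd i ℚ.* z) ℚ.+ β ℚ.* s ℚ.- μ ℚ.* z) yi≡ expand ⟩
          α ℚ.* (qd i ℚ.* (σ ℚ.* x i)) ℚ.+ β ℚ.* (σ ℚ.* sumℚ (λ j → ā i j ℚ.* x j) ℚ.+ rest) ℚ.- μ ℚ.* (σ ℚ.* x i)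
            ≡⟨ solve 8 (λ α d σ x β s r μ → α :* (d :* (σ :* x)) :+ β :* (σ :* s :+ r) :- μ :* (σ :* x)
                 := σ :* (α :* (d :* x) :+ β :* s :- μ :* x) :+ β :* r)
                 refl α (qd i) σ (x i) β (sumℚ (λ j → ā i j ℚ.* x j)) rest μ ⟩
          σ ℚ.* err ℚ.+ β ℚ.* rest ∎
          where
          open ≡-Reasoning
          rest : ℚ
          rest = sumℚ (λ j → ā i j ℚ.* (y j ℚ.- σ ℚ.* x j))
          expand : sumℚ (λ j → ā i j ℚ.* y j) ≡ σ ℚ.* sumℚ (λ j → ā i j ℚ.* x j) ℚ.+ rest
          expand = trans (sumℚ-cong λ j → solve 4 (λ a y σ x → a :* y := σ :* (a :* x) :+ a :* (y :- σ :* x))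
              refl (ā i j) (y j) σ (x j))
            (trans (sumℚ-distrib-+ (λ j → σ ℚ.* (ā i j ℚ.* x j)) _) (cong (ℚ._+ rest) (sym (*-distribˡ-sumℚ {n} σ (λ j → ā i j ℚ.* x j)))))
      signed : ℚ.∣ x i ∣ ≡ x i ⊎ ℚ.∣ x i ∣ ≡ ℚ.- x i → ℚ.- ε ℚ.≤ defect i
      signed (inj₁ eq) = with-sign 1ℚ (trans (y-abs i) (trans eq (sym (ℚP.*-identityˡ (x i)))))
        (λ j → subst₂ ℚ._≤_ (sym (ℚP.*-identityˡ (x j))) (sym (y-abs j)) (p≤∣p∣ (x j)))
        (subst (ℚ.- ε ℚ.≤_) (sym (ℚP.*-identityˡ err)) (ℚP.≤-trans (ℚP.neg-antimono-≤ err≤) (-∣p∣≤p err)))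
      signed (inj₂ eq) = with-sign (ℚ.- 1ℚ) (trans (y-abs i) (trans eq (neg (x i))))
        (λ j → subst₂ ℚ._≤_ (neg (x j)) (sym (y-abs j)) (-p≤∣p∣ (x j)))
        (subst (ℚ.- ε ℚ.≤_) (neg err) (ℚP.≤-trans (ℚP.neg-antimono-≤ err≤) (ℚP.neg-antimono-≤ (p≤∣p∣ err))))
        where
        neg : ∀ z → ℚ.- z ≡ (ℚ.- 1ℚ) ℚ.* z
        neg = solve 1 (λ z → :- z := (:- con 1ℚ) :* z) refl

-- Degree estimates behind the slacks

module DegreeBounds (G : Graph n) where
  open Degrees G

  degree<n : ∀ i → d i + 1 ≤ n
  degree<n i = begin
    d i + 1                                    ≡⟨ cong₂ _+_ (degree≡sum i) (sym (sum-⌊≟⌋ i)) ⟩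
    sum (edge i) + sum (λ j → ι ⌊ j ≟ i ⌋)     ≡⟨ ∑-distrib-+ (edge i) _ ⟨
    sum (λ j → edge i j + ι ⌊ j ≟ i ⌋)         ≤⟨ sum-mono pointwise ⟩
    sum {n} (λ _ → 1)                          ≡⟨ trans (sum-const n 1) (ℕP.*-identityʳ n) ⟩
    n                                          ∎
    where
    open ℕP.≤-Reasoning
    pointwise : ∀ j → edge i j + ι ⌊ j ≟ i ⌋ ≤ 1
    pointwise j with j ≟ i
    ... | yes refl rewrite irrefl G i = ℕP.≤-refl
    ... | no _     = ℕP.≤-trans (ℕP.≤-reflexive (ℕP.+-identityʳ _)) (ι≤1 (adj G i j))

  -- The degrees of the neighbours of j make up the degree sum less d(j) and less the degrees of the
  -- n - 1 - d(j) nonneighbours, each at least δ.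
  neighbourDegrees≤ : ∀ {δ} → (∀ v → δ ≤ d v) → ∀ j →
    sum (λ i → d i * edge i j) + d j + n * δ ≤ degreeSum + δ + d j * δ
  neighbourDegrees≤ {δ} δ≤d j = begin
    sum (λ i → d i * edge i j) + d j + n * δ
      ≡⟨ cong₂ (λ a b → sum (λ i → d i * edge i j) + a + b) (sum-indicator j d) (sum-const n δ) ⟨
    sum (λ i → d i * edge i j) + sum (λ i → ι ⌊ i ≟ j ⌋ * d i) + sum {n} (λ _ → δ)
      ≡⟨ trans (∑-distrib-+ (λ i → d i * edge i j + ι ⌊ i ≟ j ⌋ * d i) _)
           (cong (_+ sum {n} (λ _ → δ)) (∑-distrib-+ (λ i → d i * edge i j) _)) ⟨
    sum (λ i → d i * edge i j + ι ⌊ i ≟ j ⌋ * d i + δ)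
      ≤⟨ sum-mono pointwise ⟩
    sum (λ i → d i + ι ⌊ i ≟ j ⌋ * δ + edge i j * δ)
      ≡⟨ trans (∑-distrib-+ (λ i → d i + ι ⌊ i ≟ j ⌋ * δ) _)
           (cong (_+ sum (λ i → edge i j * δ)) (∑-distrib-+ d _)) ⟩
    degreeSum + sum (λ i → ι ⌊ i ≟ j ⌋ * δ) + sum (λ i → edge i j * δ)
      ≡⟨ cong₂ (λ a b → degreeSum + a + b) (sum-indicator j (λ _ → δ))
           (trans (sym (*-distribʳ-sum δ (λ i → edge i j)))
             (cong (_* δ) (trans (sum-cong-≗ λ i → edge-sym i j) (sym (degree≡sum j))))) ⟩
    degreeSum + δ + d j * δ ∎
    where
    open ℕP.≤-Reasoning
    open +-*-Solver
    pointwise : ∀ i → d i * edge i j + ι ⌊ i ≟ j ⌋ * d i + δ ≤ d i + ι ⌊ i ≟ j ⌋ * δ + edge i j * δ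
    pointwise i with i ≟ j
    ... | yes refl rewrite irrefl G i = ℕP.≤-reflexive
          (solve 2 (λ d δ → d :* con 0 :+ con 1 :* d :+ δ := d :+ con 1 :* δ :+ con 0 :* δ) refl (d i) δ)
    ... | no _ with adj G i j
    ... | true  = ℕP.≤-reflexive (solve 2 (λ d δ → d :* con 1 :+ con 0 :+ δ := d :+ con 0 :+ con 1 :* δ) refl (d i) δ)
    ... | false = ℕP.≤-trans (ℕP.≤-reflexive (solve 2 (λ d δ → d :* con 0 :+ con 0 :+ δ := δ) refl (d i) δ))
          (ℕP.≤-trans (δ≤d i) (ℕP.≤-reflexive (solve 1 (λ d → d := d :+ con 0 :+ con 0) refl (d i))))

  n*δ≤degreeSum : ∀ {δ} → (∀ v → δ ≤ d v) → n * δ ≤ degreeSum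
  n*δ≤degreeSum {δ} δ≤d = ℕP.≤-trans (ℕP.≤-reflexive (sym (sum-const n δ))) (sum-mono δ≤d)

0<*⇒0<ˡ : ∀ {u l} → 0ℚ ℚ.< u ℚ.* l → 0ℚ ℚ.< u ℚ.+ l → 0ℚ ℚ.< u
0<*⇒0<ˡ {u} {l} 0<ul 0<u+l = ℚP.≰⇒> λ u≤0 →
  let 0≤l = ℚP.≮⇒≥ λ l<0 → ℚP.<-irrefl refl (ℚP.<-trans 0<u+l (ℚP.+-mono-≤-< u≤0 l<0))
  in ℚP.<-irrefl refl (ℚP.<-≤-trans 0<ul (subst (u ℚ.* l ℚ.≤_) (ℚP.*-zeroˡ l)
       (ℚP.*-monoʳ-≤-nonNeg l {{ℚ.nonNegative 0≤l}} u≤0)))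

-- Stated for arbitrary reals, so that `refl` unfolds the outer operations only and not the sums
-- substituted later.
seq-defect-form : ∀ (α μ p r v : ℝ) k m {z} → seq r m ≡ z →
  seq (α *ᴿ (natᴿ k *ᴿ p) +ᴿ (1ᴿ -ᴿ α) *ᴿ r -ᴿ μ *ᴿ v) m ≡
  seq α m ℚ.* (toℚ k ℚ.* seq p m) ℚ.+ (1ℚ ℚ.- seq α m) ℚ.* z ℚ.- seq μ m ℚ.* seq v m
seq-defect-form α μ p r v k m refl = refl

seq-identity-form : ∀ (x₁ α x₂ β x₃ ν x₄ : ℝ) m {z₁ z₂ z₃ z₄} →
  seq x₁ m ≡ z₁ → seq x₂ m ≡ z₂ → seq x₃ m ≡ z₃ → seq x₄ m ≡ z₄ →
  seq (x₁ +ᴿ α *ᴿ x₂ +ᴿ β *ᴿ x₃ +ᴿ ν *ᴿ x₄) m ≡ z₁ ℚ.+ seq α m ℚ.* z₂ ℚ.+ seq β m ℚ.* z₃ ℚ.+ seq ν m ℚ.* z₄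
seq-identity-form x₁ α x₂ β x₃ ν x₄ m refl refl refl refl = refl

module _ (G : Graph n) {δ H : ℕ} (δ≤d : ∀ v → δ ℕ.≤ degree G v)
  (D≤H : Degrees.degreeSum G ℕ.≤ H) (α μ : ℝ)
  (0≤α : Nonneg α) (0≤β : Eventually λ m → 0ℚ ℚ.≤ 1ℚ ℚ.- seq α m) where
  open Degrees G
  open DegreeBounds G

  private
    β b c : ℝ
    β = 1ᴿ -ᴿ α
    b = natᴿ δ +ᴿ α *ᴿ natᴿ n -ᴿ α *ᴿ natᴿ δ -ᴿ 1ᴿ
    c = β *ᴿ (natᴿ H -ᴿ natᴿ (n ℕ.* δ) +ᴿ natᴿ δ)

    seq-if : ∀ t (x y : ℝ) m → seq (if t then x else y) m ≡ (if t then seq x m else seq y m)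
    seq-if true  x y m = refl
    seq-if false x y m = refl

    seq-degree : ∀ i j m → seq (degreeMatrix G i j) m ≡ (if ⌊ i ≟ j ⌋ then toℚ (d i) else 0ℚ)
    seq-degree i j m = trans (seq-if ⌊ i ≟ j ⌋ (fromℕ (d i)) 0ᴿ m) (cong (λ z → if ⌊ i ≟ j ⌋ then z else 0ℚ) (sym (toℚ-def (d i))))

    seq-adjacency : ∀ i j m → seq (adjacencyMatrix G i j) m ≡ toℚ (edge i j)
    seq-adjacency i j m = trans (seq-if (adj G i j) 1ᴿ 0ᴿ m) (toℚ-ι (adj G i j))
      where
      toℚ-ι : ∀ t → (if t then 1ℚ else 0ℚ) ≡ toℚ (ι t)
      toℚ-ι true  = sym (toℚ-def 1)
      toℚ-ι false = sym (toℚ-def 0)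

  seq-row : ∀ (x : Fin n → ℝ) i m → seq (∑ λ j → A[_] G α i j *ᴿ x j) m ≡
    seq α m ℚ.* (toℚ (d i) ℚ.* seq (x i) m) ℚ.+ (1ℚ ℚ.- seq α m) ℚ.* sumℚ (λ j → toℚ (edge i j) ℚ.* seq (x j) m)
  seq-row x i m = begin
    seq (∑ λ j → A[_] G α i j *ᴿ x j) m
      ≡⟨ seq-∑ (λ j → A[_] G α i j *ᴿ x j) m ⟩
    sumℚ (λ j → (a ℚ.* seq (degreeMatrix G i j) m ℚ.+ (1ℚ ℚ.- a) ℚ.* seq (adjacencyMatrix G i j) m) ℚ.* seq (x j) m)
      ≡⟨ sumℚ-cong (λ j → trans (cong₂ (λ p r → (a ℚ.* p ℚ.+ (1ℚ ℚ.- a) ℚ.* r) ℚ.* seq (x j) m) (seq-degree i j m) (seq-adjacency i j m))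
           (solve 5 (λ a p b r x → (a :* p :+ b :* r) :* x := a :* (p :* x) :+ b :* (r :* x)) refl
             a (diag j) (1ℚ ℚ.- a) (toℚ (edge i j)) (seq (x j) m))) ⟩
    sumℚ (λ j → a ℚ.* (diag j ℚ.* seq (x j) m) ℚ.+ (1ℚ ℚ.- a) ℚ.* (toℚ (edge i j) ℚ.* seq (x j) m))
      ≡⟨ sumℚ-distrib-+ (λ j → a ℚ.* (diag j ℚ.* seq (x j) m)) _ ⟩
    sumℚ (λ j → a ℚ.* (diag j ℚ.* seq (x j) m)) ℚ.+ sumℚ (λ j → (1ℚ ℚ.- a) ℚ.* (toℚ (edge i j) ℚ.* seq (x j) m))
      ≡⟨ cong₂ ℚ._+_ (trans (sym (*-distribˡ-sumℚ a (λ j → diag j ℚ.* seq (x j) m))) (cong (a ℚ.*_) diagonal))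
           (sym (*-distribˡ-sumℚ (1ℚ ℚ.- a) (λ j → toℚ (edge i j) ℚ.* seq (x j) m))) ⟩
    a ℚ.* (toℚ (d i) ℚ.* seq (x i) m) ℚ.+ (1ℚ ℚ.- a) ℚ.* sumℚ (λ j → toℚ (edge i j) ℚ.* seq (x j) m) ∎
    where
    open ≡-Reasoning
    open ℚS.+-*-Solver
    a : ℚ
    a = seq α m
    diag : Fin n → ℚ
    diag j = if ⌊ i ≟ j ⌋ then toℚ (d i) else 0ℚ
    diagonal : sumℚ (λ j → diag j ℚ.* seq (x j) m) ≡ toℚ (d i) ℚ.* seq (x i) m
    diagonal = trans (sumℚ-single i off) (cong (ℚ._* seq (x i) m) on)
      where
      on : diag i ≡ toℚ (d i)
      on with i ≟ i
      ... | yes _  = refl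
      ... | no i≢i = contradiction refl i≢i
      off : ∀ j → j ≢ i → diag j ℚ.* seq (x j) m ≡ 0ℚ
      off j j≢i with i ≟ j
      ... | yes refl = contradiction refl j≢i
      ... | no _     = ℚP.*-zeroˡ (seq (x j) m)

  module _ (x : Fin n → ℝ) (eigen : ∀ i → ∑ (λ j → A[_] G α i j *ᴿ x j) ≃ μ *ᴿ x i) where

    total : ℝ
    total = ∑ (λ i → absᴿ (x i))

    defectᴿ : Fin n → ℝ
    defectᴿ i = α *ᴿ (natᴿ (d i) *ᴿ absᴿ (x i)) +ᴿ β *ᴿ ∑ (λ j → natᴿ (edge i j) *ᴿ absᴿ (x j)) -ᴿ μ *ᴿ absᴿ (x i)

    private module I m = Identity G (λ i → ℚ.∣ seq (x i) m ∣) (seq α m) (seq μ m)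

    seq-defect : ∀ i m → seq (defectᴿ i) m ≡ I.defect m i
    seq-defect i m = seq-defect-form α μ (absᴿ (x i)) (∑ (λ j → natᴿ (edge i j) *ᴿ absᴿ (x j))) (absᴿ (x i)) (d i) m (seq-weighted (edge i) x m)

    Nonneg-defect : ∀ i → Nonneg (defectᴿ i)
    Nonneg-defect i ε 0<ε = eventually-map lower (both (eigen i ε 0<ε) 0≤β)
      where
      lower : ∀ m → (ℚ.∣ seq (∑ λ j → A[_] G α i j *ᴿ x j) m ℚ.- seq μ m ℚ.* seq (x i) m ∣ ℚ.< ε) × (0ℚ ℚ.≤ 1ℚ ℚ.- seq α m) →
              ℚ.- ε ℚ.≤ seq (defectᴿ i) m
      lower m (err< , 0≤β) = subst (ℚ.- ε ℚ.≤_) (sym (seq-defect i m))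
        (I.defect≥ m (λ j → seq (x j) m) 0≤β (λ j → refl) i
          (subst (λ z → ℚ.∣ z ℚ.- seq μ m ℚ.* seq (x i) m ∣ ℚ.≤ ε) (seq-row x i m) (ℚP.<⇒≤ err<)))

    weighted : (Fin n → ℕ) → ℝ
    weighted e = ∑ (λ i → natᴿ (e i) *ᴿ absᴿ (x i))

    Nonneg-weighted : ∀ e → Nonneg (weighted e)
    Nonneg-weighted e = Nonneg-∑ (λ i → natᴿ (e i) *ᴿ absᴿ (x i)) λ i →
      eventually⇒Nonneg (natᴿ (e i) *ᴿ absᴿ (x i)) (always λ m → 0≤* (0≤toℚ (e i)) (ℚP.0≤∣p∣ (seq (x i) m)))

    weighted-defect : ℝ
    weighted-defect = ∑ (λ i → natᴿ (d i) *ᴿ defectᴿ i)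

    Nonneg-weighted-defect : Nonneg weighted-defect
    Nonneg-weighted-defect = Nonneg-∑ (λ i → natᴿ (d i) *ᴿ defectᴿ i) λ i →
      Nonneg-* (natᴿ (d i)) (defectᴿ i) (Nonneg-natᴿ (d i)) (Nonneg-defect i)

    seq-weighted-defect : ∀ m → seq weighted-defect m ≡ sumℚ (λ i → toℚ (d i) ℚ.* I.defect m i)
    seq-weighted-defect m = trans (seq-∑ (λ i → natᴿ (d i) *ᴿ defectᴿ i) m)
      (sumℚ-cong λ i → cong (toℚ (d i) ℚ.*_) (seq-defect i m))

    seq-sum-defect : ∀ m → seq (∑ defectᴿ) m ≡ sumℚ (I.defect m)
    seq-sum-defect m = trans (seq-∑ defectᴿ m) (sumℚ-cong λ i → seq-defect i m)

    -- With B = A_α and y = |x|, summing the coordinates of (B + (μ - b) I)(B y - μ y) ≥ 0.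
    Nonneg-charpoly : Nonneg (μ -ᴿ b) → Nonneg ((c -ᴿ (μ -ᴿ b) *ᴿ μ) *ᴿ total)
    Nonneg-charpoly 0≤μ-b = Nonneg-≡ X ((c -ᴿ (μ -ᴿ b) *ᴿ μ) *ᴿ total) identity
      (Nonneg-+ (X₁ +ᴿ X₂ +ᴿ X₃) X₄ (Nonneg-+ (X₁ +ᴿ X₂) X₃ (Nonneg-+ X₁ X₂ Nonneg-weighted-defect
        (Nonneg-* α (weighted rr′) 0≤α (Nonneg-weighted rr′)))
        (Nonneg-* β (weighted r) (eventually⇒Nonneg β 0≤β) (Nonneg-weighted r)))
        (Nonneg-* (μ -ᴿ b) (∑ defectᴿ) 0≤μ-b (Nonneg-∑ defectᴿ Nonneg-defect)))
      where
      slack : ∀ i → ∃[ o ] d i ℕ.+ 1 ℕ.+ o ≡ n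
      slack i = ℕP.m≤n⇒∃[o]m+o≡n (degree<n i)
      slack′ : ∀ j → ∃[ o ] sum (λ i → d i ℕ.* edge i j) ℕ.+ d j ℕ.+ n ℕ.* δ ℕ.+ o ≡ H ℕ.+ δ ℕ.+ d j ℕ.* δ
      slack′ j = ℕP.m≤n⇒∃[o]m+o≡n (ℕP.≤-trans (neighbourDegrees≤ δ≤d j) (ℕP.+-monoˡ-≤ (d j ℕ.* δ) (ℕP.+-monoˡ-≤ δ D≤H)))
      r r′ rr′ : Fin n → ℕ
      r j = proj₁ (slack′ j)
      r′ i = proj₁ (slack i)
      rr′ i = d i ℕ.* r′ i
      X₁ X₂ X₃ X₄ X : ℝ
      X₁ = weighted-defect
      X₂ = α *ᴿ weighted rr′
      X₃ = β *ᴿ weighted r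
      X₄ = (μ -ᴿ b) *ᴿ ∑ defectᴿ
      X = X₁ +ᴿ X₂ +ᴿ X₃ +ᴿ X₄
      identity : ∀ m → seq X m ≡ seq ((c -ᴿ (μ -ᴿ b) *ᴿ μ) *ᴿ total) m
      identity m = trans
        (seq-identity-form weighted-defect α (weighted rr′) β (weighted r) (μ -ᴿ b) (∑ defectᴿ) m
          (seq-weighted-defect m) (seq-weighted rr′ x m) (seq-weighted r x m) (seq-sum-defect m))
        (trans (I.defect-identity m r r′ (λ i → proj₂ (slack i)) (λ j → proj₂ (slack′ j)))
          (cong (seq (c -ᴿ (μ -ᴿ b) *ᴿ μ) m ℚ.*_) (sym (seq-∑ (λ i → absᴿ (x i)) m))))

  Nonneg-c : Nonneg c
  Nonneg-c = Nonneg-* β (natᴿ H -ᴿ natᴿ (n ℕ.* δ) +ᴿ natᴿ δ) (eventually⇒Nonneg β 0≤β)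
    (eventually⇒Nonneg (natᴿ H -ᴿ natᴿ (n ℕ.* δ) +ᴿ natᴿ δ) (always λ _ →
      ℚP.+-mono-≤ (≤⇒0≤- (toℚ-mono (ℕP.≤-trans (n*δ≤degreeSum δ≤d) D≤H))) (0≤toℚ δ)))
    where
    toℚ-mono : ∀ {k m} → k ℕ.≤ m → toℚ k ℚ.≤ toℚ m
    toℚ-mono {k} k≤m with o , refl ← ℕP.m≤n⇒∃[o]m+o≡n k≤m = subst₂ ℚ._≤_ (ℚP.+-identityʳ (toℚ k)) (sym (toℚ-+ k o)) (ℚP.+-monoʳ-≤ (toℚ k) (0≤toℚ o))

-- The quadratic inequality, with a rational margin

module Gap (μ b β k s : ℝ) (0≤βk : Nonneg (β *ᴿ k)) (0≤s : Nonneg s)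
  (s²≃ : s *ᴿ s ≃ b *ᴿ b +ᴿ fromℕ 4 *ᴿ β *ᴿ k) (ε : ℚ) (0<ε : 0ℚ ℚ.< ε)
  (above : Eventually λ m → seq (fromℚ ½ *ᴿ (b +ᴿ s)) m ℚ.+ ε ℚ.≤ seq μ m) where
  open ℚS.+-*-Solver

  4ℚ e : ℚ
  4ℚ = (ℤ.+ 4) ℚ./ 1
  -- From 2μ - b ≥ s + 2ε and s ≥ 0 follows (2μ - b)² - s² ≥ 4ε², so (μ - b)μ exceeds c by at least
  -- ε².
  e = ε ℚ.* ε

  c P 4ε R gap : ℝ
  c = β *ᴿ k
  P = μ +ᴿ μ -ᴿ b -ᴿ s -ᴿ fromℚ (ε ℚ.+ ε)
  4ε = fromℚ (ε ℚ.+ ε ℚ.+ (ε ℚ.+ ε))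
  R = b *ᴿ b +ᴿ fromℕ 4 *ᴿ β *ᴿ k
  gap = (μ -ᴿ b) *ᴿ μ -ᴿ c -ᴿ fromℚ e

  0≤P : Nonneg P
  0≤P = eventually⇒Nonneg P (eventually-map (λ m h → subst (0ℚ ℚ.≤_)
    (solve 4 (λ μ b s ε → μ :- (con ½ :* (b :+ s) :+ ε) :+ (μ :- (con ½ :* (b :+ s) :+ ε)) := μ :+ μ :- b :- s :- (ε :+ ε))
      refl (seq μ m) (seq b m) (seq s m) ε)
    (ℚP.+-mono-≤ (≤⇒0≤- h) (≤⇒0≤- h))) above)

  const : ∀ {r} → 0ℚ ℚ.≤ r → Nonneg (fromℚ r)
  const {r} 0≤r = eventually⇒Nonneg (fromℚ r) (always λ _ → 0≤r)

  0≤4ε : Nonneg 4ε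
  0≤4ε = const (ℚP.+-mono-≤ 0≤2ε 0≤2ε)
    where
    0≤2ε : 0ℚ ℚ.≤ ε ℚ.+ ε
    0≤2ε = ℚP.+-mono-≤ (ℚP.<⇒≤ 0<ε) (ℚP.<⇒≤ 0<ε)

  0<e : 0ℚ ℚ.< e
  0<e = subst (ℚ._< e) (ℚP.*-zeroʳ ε) (ℚP.*-monoʳ-<-pos ε {{ℚ.positive 0<ε}} 0<ε)

  -- 4 ((μ - b) μ - c) = (2μ - b)² - s², and 2μ - b ≥ s + 2ε.
  Nonneg-gap : Nonneg gap
  Nonneg-gap = Nonneg-≡ W gap identity
    (Nonneg-* (fromℚ (½ ℚ.* ½)) (W₁ +ᴿ W₂ +ᴿ W₃) (const (ℚP.nonNegative⁻¹ (½ ℚ.* ½)))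
      (Nonneg-+ (W₁ +ᴿ W₂) W₃ (Nonneg-+ W₁ W₂
        (Nonneg-* P (P +ᴿ 4ε) 0≤P (Nonneg-+ P 4ε 0≤P 0≤4ε))
        (Nonneg-* (P +ᴿ P +ᴿ 4ε) s (Nonneg-+ (P +ᴿ P) 4ε (Nonneg-+ P P 0≤P 0≤P) 0≤4ε) 0≤s))
        (≃⇒Nonneg (s *ᴿ s) R s²≃)))
    where
    W₁ W₂ W₃ W : ℝ
    W₁ = P *ᴿ (P +ᴿ 4ε)
    W₂ = (P +ᴿ P +ᴿ 4ε) *ᴿ s
    W₃ = s *ᴿ s -ᴿ R
    W = fromℚ (½ ℚ.* ½) *ᴿ (W₁ +ᴿ W₂ +ᴿ W₃)
    completed-square : ∀ p s ε → ½ ℚ.* ½ ℚ.* (p ℚ.* (p ℚ.+ (ε ℚ.+ ε ℚ.+ (ε ℚ.+ ε))) ℚ.+ (p ℚ.+ p ℚ.+ (ε ℚ.+ ε ℚ.+ (ε ℚ.+ ε))) ℚ.* s)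
      ≡ ½ ℚ.* ½ ℚ.* ((p ℚ.+ s ℚ.+ (ε ℚ.+ ε)) ℚ.* (p ℚ.+ s ℚ.+ (ε ℚ.+ ε)) ℚ.- s ℚ.* s) ℚ.- ε ℚ.* ε
    completed-square = solve 3 (λ p s ε → con (½ ℚ.* ½) :* (p :* (p :+ (ε :+ ε :+ (ε :+ ε))) :+ (p :+ p :+ (ε :+ ε :+ (ε :+ ε))) :* s)
      := con (½ ℚ.* ½) :* ((p :+ s :+ (ε :+ ε)) :* (p :+ s :+ (ε :+ ε)) :- s :* s) :- ε :* ε) refl
    sum-P : ∀ μ b s ε → μ ℚ.+ μ ℚ.- b ℚ.- s ℚ.- (ε ℚ.+ ε) ℚ.+ s ℚ.+ (ε ℚ.+ ε) ≡ μ ℚ.+ μ ℚ.- b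
    sum-P = solve 4 (λ μ b s ε → μ :+ μ :- b :- s :- (ε :+ ε) :+ s :+ (ε :+ ε) := μ :+ μ :- b) refl
    identity : ∀ m → seq W m ≡ seq gap m
    identity m = begin
      ½ ℚ.* ½ ℚ.* (w₁₂ ℚ.+ (s̃ ℚ.* s̃ ℚ.- (b̃ ℚ.* b̃ ℚ.+ 4ℚ ℚ.* β̃ ℚ.* k̃)))
        ≡⟨ ℚP.*-distribˡ-+ (½ ℚ.* ½) w₁₂ _ ⟩
      ½ ℚ.* ½ ℚ.* w₁₂ ℚ.+ ½ ℚ.* ½ ℚ.* (s̃ ℚ.* s̃ ℚ.- (b̃ ℚ.* b̃ ℚ.+ 4ℚ ℚ.* β̃ ℚ.* k̃))
        ≡⟨ cong (ℚ._+ ½ ℚ.* ½ ℚ.* (s̃ ℚ.* s̃ ℚ.- (b̃ ℚ.* b̃ ℚ.+ 4ℚ ℚ.* β̃ ℚ.* k̃))) (trans (completed-square (seq P m) s̃ ε)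
             (cong (λ z → ½ ℚ.* ½ ℚ.* (z ℚ.* z ℚ.- s̃ ℚ.* s̃) ℚ.- ε ℚ.* ε) (sum-P μ̃ b̃ s̃ ε))) ⟩
      ½ ℚ.* ½ ℚ.* ((μ̃ ℚ.+ μ̃ ℚ.- b̃) ℚ.* (μ̃ ℚ.+ μ̃ ℚ.- b̃) ℚ.- s̃ ℚ.* s̃) ℚ.- ε ℚ.* ε ℚ.+ ½ ℚ.* ½ ℚ.* (s̃ ℚ.* s̃ ℚ.- (b̃ ℚ.* b̃ ℚ.+ 4ℚ ℚ.* β̃ ℚ.* k̃))
        ≡⟨ solve 6 (λ μ b S e β k → con (½ ℚ.* ½) :* ((μ :+ μ :- b) :* (μ :+ μ :- b) :- S) :- e :+ con (½ ℚ.* ½) :* (S :- (b :* b :+ con 4ℚ :* β :* k))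
             := (μ :- b) :* μ :- β :* k :- e) refl μ̃ b̃ (s̃ ℚ.* s̃) (ε ℚ.* ε) β̃ k̃ ⟩
      (μ̃ ℚ.- b̃) ℚ.* μ̃ ℚ.- β̃ ℚ.* k̃ ℚ.- ε ℚ.* ε ∎
      where
      open ≡-Reasoning
      μ̃ b̃ s̃ β̃ k̃ w₁₂ : ℚ
      μ̃ = seq μ m
      b̃ = seq b m
      s̃ = seq s m
      β̃ = seq β m
      k̃ = seq k m
      w₁₂ = seq W₁ m ℚ.+ seq W₂ m

  -- The product (μ - b)μ exceeds c ≥ 0, and the sum (μ - b) + μ is positive too, so eventually both
  -- factors are positive. This supplies the sign of the multiplier in `Nonneg-charpoly`.
  Nonneg-μ-b : Nonneg (μ -ᴿ b)
  Nonneg-μ-b = eventually⇒Nonneg (μ -ᴿ b) (eventually-map positive (both product sum₂))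
    where
    product : Eventually λ m → 0ℚ ℚ.< seq ((μ -ᴿ b) *ᴿ μ) m
    product = Nonneg⇒positive ((μ -ᴿ b) *ᴿ μ) e 0<e (Nonneg-≡ (gap +ᴿ c) ((μ -ᴿ b) *ᴿ μ -ᴿ fromℚ e)
      (λ m → solve 3 (λ u c e → u :- c :- e :+ c := u :- e) refl (seq ((μ -ᴿ b) *ᴿ μ) m) (seq c m) e)
      (Nonneg-+ gap c Nonneg-gap 0≤βk))
    sum₂ : Eventually λ m → 0ℚ ℚ.< seq (μ +ᴿ μ -ᴿ b) m
    sum₂ = Nonneg⇒positive (μ +ᴿ μ -ᴿ b) (ε ℚ.+ ε) (ℚP.+-mono-< 0<ε 0<ε)
      (Nonneg-≡ (P +ᴿ s) (μ +ᴿ μ -ᴿ b -ᴿ fromℚ (ε ℚ.+ ε))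
        (λ m → solve 3 (λ u s e → u :- s :- e :+ s := u :- e) refl (seq (μ +ᴿ μ -ᴿ b) m) (seq s m) (ε ℚ.+ ε))
        (Nonneg-+ P s 0≤P 0≤s))
    positive : ∀ m → (0ℚ ℚ.< seq ((μ -ᴿ b) *ᴿ μ) m) × (0ℚ ℚ.< seq (μ +ᴿ μ -ᴿ b) m) → 0ℚ ℚ.≤ seq (μ -ᴿ b) m
    positive m (0<product , 0<sum) = ℚP.<⇒≤ (0<*⇒0<ˡ 0<product
      (subst (0ℚ ℚ.<_) (solve 2 (λ μ b → μ :+ μ :- b := μ :- b :+ μ) refl (seq μ m) (seq b m)) 0<sum))

  -- Adding the product of `gap` and S to (c - (μ - b)μ)S ≥ 0 leaves -ε²S ≥ 0. Owing to the rational
  -- margin, only ε² has to be cancelled to conclude that S tends to 0.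
  vanishes : ∀ S → Nonneg S → Nonneg ((c -ᴿ (μ -ᴿ b) *ᴿ μ) *ᴿ S) →
    ∀ η → 0ℚ ℚ.< η → Eventually λ m → seq S m ℚ.≤ η
  vanishes S 0≤S charpoly η 0<η = eventually-map small (upper (e ℚ.* η)
      (subst (ℚ._< e ℚ.* η) (ℚP.*-zeroʳ e) (ℚP.*-monoʳ-<-pos e {{ℚ.positive 0<e}} 0<η)))
    where
    upper : Nonneg (-ᴿ (fromℚ e *ᴿ S))
    upper = Nonneg-≡ (gap *ᴿ S +ᴿ (c -ᴿ (μ -ᴿ b) *ᴿ μ) *ᴿ S) (-ᴿ (fromℚ e *ᴿ S))
      (λ m → solve 4 (λ u c e T → (u :- c :- e) :* T :+ (c :- u) :* T := :- (e :* T)) refl (seq ((μ -ᴿ b) *ᴿ μ) m) (seq c m) e (seq S m))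
      (Nonneg-+ (gap *ᴿ S) ((c -ᴿ (μ -ᴿ b) *ᴿ μ) *ᴿ S) (Nonneg-* gap S Nonneg-gap 0≤S) charpoly)
    small : ∀ m → ℚ.- (e ℚ.* η) ℚ.≤ ℚ.- (e ℚ.* seq S m) → seq S m ℚ.≤ η
    small m h = ℚP.*-cancelˡ-≤-pos e {{ℚ.positive 0<e}} (neg-cancel-≤ h)

-- Conclusion

coordinate-zero : (x : Fin n → ℝ) → (∀ η → 0ℚ ℚ.< η → Eventually λ m → seq (∑ λ i → absᴿ (x i)) m ℚ.≤ η) →
  ∀ i → x i ≃ 0ᴿ
coordinate-zero x small i η 0<η = eventually-map close (small (½ ℚ.* η) (CauchyLemmas.half-pos η 0<η))
  where
  close : ∀ m → seq (∑ λ i → absᴿ (x i)) m ℚ.≤ ½ ℚ.* η → ℚ.∣ seq (x i) m ℚ.- 0ℚ ∣ ℚ.< η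
  close m h = begin-strict
    ℚ.∣ seq (x i) m ℚ.- 0ℚ ∣  ≡⟨ cong ℚ.∣_∣ (ℚP.+-identityʳ (seq (x i) m)) ⟩
    ℚ.∣ seq (x i) m ∣         ≤⟨ termℚ≤sum (λ i → ℚP.0≤∣p∣ (seq (x i) m)) i ⟩
    sumℚ (λ i → ℚ.∣ seq (x i) m ∣) ≡⟨ seq-∑ (λ i → absᴿ (x i)) m ⟨
    seq (∑ λ i → absᴿ (x i)) m ≤⟨ h ⟩
    ½ ℚ.* η                   <⟨ subst₂ ℚ._<_ (ℚP.+-identityʳ (½ ℚ.* η)) (CauchyLemmas.halves η)
                                   (ℚP.+-monoʳ-< (½ ℚ.* η) (CauchyLemmas.half-pos η 0<η)) ⟩
    η                         ∎
    where open ℚP.≤-Reasoning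

-- The four constants are left free so that the opaque `toℚ` values can be exchanged for literal
-- fractions by matching on `refl`.
EigenvalueBound : (G : Graph n) (α μ s : ℝ) (δ′ n′ H′ nδ : ℚ) → Set
EigenvalueBound G α μ s δ′ n′ H′ nδ =
  let b = fromℚ δ′ +ᴿ α *ᴿ fromℚ n′ -ᴿ α *ᴿ fromℚ δ′ -ᴿ 1ᴿ in
  IsSqrt (b *ᴿ b +ᴿ fromℕ 4 *ᴿ (1ᴿ -ᴿ α) *ᴿ (fromℚ H′ -ᴿ fromℚ nδ +ᴿ fromℚ δ′)) s →
  μ ≤ᴿ fromℚ ½ *ᴿ (b +ᴿ s)

eigenvalue≤ : (G : Graph n) {δ H : ℕ} → (∀ v → δ ℕ.≤ degree G v) → Degrees.degreeSum G ℕ.≤ H →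
  (α : ℝ) → 0ᴿ ≤ᴿ α → α <ᴿ 1ᴿ → (μ : ℝ) → IsEigenvalue (A[_] G α) μ →
  let b = fromℕ δ +ᴿ α *ᴿ fromℕ n -ᴿ α *ᴿ fromℕ δ -ᴿ 1ᴿ in
  (s : ℝ) → IsSqrt (b *ᴿ b +ᴿ fromℕ 4 *ᴿ (1ᴿ -ᴿ α) *ᴿ (fromℕ H -ᴿ fromℕ (n ℕ.* δ) +ᴿ fromℕ δ)) s →
  μ ≤ᴿ fromℚ ½ *ᴿ (b +ᴿ s)
eigenvalue≤ {n} G {δ} {H} δ≤d D≤H α 0≤α (e , 0<e , N , α<1) μ (x , x≄0 , eigen) s =
  transfer (toℚ-def δ) (toℚ-def n) (toℚ-def H) (toℚ-def (n ℕ.* δ)) bound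
  where
  transfer : ∀ {δ₁ δ₂ n₁ n₂ H₁ H₂ m₁ m₂} → δ₁ ≡ δ₂ → n₁ ≡ n₂ → H₁ ≡ H₂ → m₁ ≡ m₂ →
    EigenvalueBound G α μ s δ₁ n₁ H₁ m₁ → EigenvalueBound G α μ s δ₂ n₂ H₂ m₂
  transfer refl refl refl refl h = h
  0≤β : Eventually λ m → 0ℚ ℚ.≤ 1ℚ ℚ.- seq α m
  0≤β = N , λ m m≥ → ≤⇒0≤- (ℚP.≤-trans (subst (ℚ._≤ seq α m ℚ.+ e) (ℚP.+-identityʳ (seq α m))
    (ℚP.+-monoʳ-≤ (seq α m) (ℚP.<⇒≤ 0<e))) (α<1 m m≥))
  bound : EigenvalueBound G α μ s (toℚ δ) (toℚ n) (toℚ H) (toℚ (n ℕ.* δ))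
  -- The goal `≤ᴿ` is a negation: the assumed strict excess provides ε, and then all coordinates of
  -- the eigenvector tend to 0, contrary to `x≄0`.
  bound (0≤s , s²≃) (ε , 0<ε , above) = x≄0 (coordinate-zero x (G.vanishes (∑ λ i → absᴿ (x i))
      (Nonneg-∑ (λ i → absᴿ (x i)) λ i → eventually⇒Nonneg (absᴿ (x i)) (always λ m → ℚP.0≤∣p∣ (seq (x i) m)))
      (Nonneg-charpoly G δ≤d D≤H α μ (0≤ᴿ⇒Nonneg α 0≤α) 0≤β x eigen G.Nonneg-μ-b)))
    where
    module G = Gap μ (natᴿ δ +ᴿ α *ᴿ natᴿ n -ᴿ α *ᴿ natᴿ δ -ᴿ 1ᴿ) (1ᴿ -ᴿ α) (natᴿ H -ᴿ natᴿ (n ℕ.* δ) +ᴿ natᴿ δ) s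
      (Nonneg-c G δ≤d D≤H α μ (0≤ᴿ⇒Nonneg α 0≤α) 0≤β) (0≤ᴿ⇒Nonneg s 0≤s) s²≃ ε 0<ε above

corollary2p8 : ∀ (n t δ : ℕ) → 3 ≤ n → 3 ≤ t + 1 → t + 1 ≤ δ → δ ≤ maxδ n t →
    ∀ (α : ℝ) → 0ᴿ ≤ᴿ α → α <ᴿ 1ᴿ →
    ∀ (G : Graph n) → Connected G → HasMinDegree G δ →
    let b = fromℕ δ +ᴿ α *ᴿ fromℕ n -ᴿ α *ᴿ fromℕ δ -ᴿ 1ᴿ in
    ∀ (λα : ℝ) → Is-α-SpectralRadius G α λα →
    ∀ (s : ℝ) →
    IsSqrt (b *ᴿ b +ᴿ fromℕ 4 *ᴿ (1ᴿ -ᴿ α) *ᴿ (fromℕ (2 * h₁ n t δ) -ᴿ fromℕ (n * δ) +ᴿ fromℕ δ)) s →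
    fromℚ ½ *ᴿ (b +ᴿ s) <ᴿ λα →
    OneToManyDisjointPathCoverable G t
corollary2p8 n t δ _ 3≤t+1 t<δ _ α 0≤α α<1 G _ minDegree λα (eigenvalue , _) s sqrt large =
  dense⇒coverable G 2≤t (≤-trans (ℕP.m≤m+n t 1) t<δ) minDegree
    -- Order on the naturals is decidable, so it suffices to refute sparsity, under which
    -- `eigenvalue≤` contradicts `large`.
    (decidable-stable (_ <? _) λ sparse →
      eigenvalue≤ G (proj₁ minDegree) (ℕP.≮⇒≥ sparse) α 0≤α α<1 λα eigenvalue s sqrt large)
  where
  2≤t : 2 ≤ t
  2≤t = ℕP.+-cancelʳ-≤ 1 2 t 3≤t+1
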